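{- For every integer $n \ge 3$: $\phi_{6n}(1) = v(n)$ if $v(n) \equiv 1 \pmod 3$, and $\phi_{6n}(1) = -v(n)$ if $v(n) \equiv -1 \pmod 3$ or $v(n) = 2$ or $v(n) = 3$.
   Context: For an integer $m \ge 3$, let $\phi_m(x) \in \mathbb{Z}[x]$ denote the minimal polynomial of $4\sin^2\left(\frac{\pi}{m}\right)$, normalized (up to sign) so that its constant term is positive; equivalently, $\phi_m(x) = \prod_{0 < j < \frac{m}{2},\ \gcd(j,m)=1} \left(4\sin^2\left(\frac{j\pi}{m}\right) - x\right)$. For an integer $n > 1$, define $v(n) = p$ if $n = p^k$ is a power ($k \ge 1$) of a prime $p$, and $v(n) = 1$ otherwise. -}

module Defs where

open import Level using (Level; _⊔_)
open import Data.Nat as ℕ using (ℕ; zero; suc; _≤_; _<_)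
open import Data.Nat.Primality using (Prime)
open import Data.Nat.Coprimality using (Coprime; coprime?)
open import Data.Product using (Σ; _×_; ∃)
open import Data.Sum using (_⊎_)
open import Data.Bool using (if_then_else_)
open import Relation.Nullary using (¬_; does)
open import Relation.Nullary.Decidable using (_×-dec_)
open import Relation.Binary.PropositionalEquality using (_≡_)
open import Algebra.Bundles using (CommutativeRing)

module _ {c ℓ : Level} (R : CommutativeRing c ℓ) where
  open CommutativeRing R

  pow : Carrier → ℕ → Carrier
  pow x zero    = 1#
  pow x (suc k) = x * pow x k

  fromℕ : ℕ → Carrier
  fromℕ zero    = 0#
  fromℕ (suc k) = 1# + fromℕ k

  IsIntegralDomain : Set (c ⊔ ℓ)
  IsIntegralDomain = (¬ (1# ≈ 0#)) × (∀ a b → a * b ≈ 0# → (a ≈ 0#) ⊎ (b ≈ 0#))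

  CharZero : Set ℓ
  CharZero = ∀ k → ¬ (fromℕ (suc k) ≈ 0#)

  IsPrimitiveRoot : ℕ → Carrier → Set ℓ
  IsPrimitiveRoot m ζ = (pow ζ m ≈ 1#) × (∀ d → 1 ≤ d → d < m → ¬ (pow ζ d ≈ 1#))

  -- 4 sin²(jπ/m) = 2 - ζ^j - ζ^{-j}, with ζ = e^{2πi/m} and ζ^{-j} = ζ^{m-j}
  fourSinSq : ℕ → Carrier → ℕ → Carrier
  fourSinSq m ζ j = (1# + 1#) - pow ζ j - pow ζ (m ℕ.∸ j)

  φ-aux : ℕ → Carrier → Carrier → ℕ → Carrier
  φ-aux m ζ x zero    = 1#
  φ-aux m ζ x (suc j) =
    if does ((1 ℕ.≤? j) ×-dec ((2 ℕ.* j) ℕ.<? m) ×-dec coprime? j m)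
    then (fourSinSq m ζ j - x) * φ-aux m ζ x j
    else φ-aux m ζ x j

  φ : ℕ → Carrier → Carrier → Carrier
  φ m ζ x = φ-aux m ζ x m

IsPrimePower : ℕ → Set
IsPrimePower n = Σ ℕ λ p → Σ ℕ λ k → Prime p × 1 ≤ k × n ≡ p ℕ.^ k

IsV : ℕ → ℕ → Set
IsV n w = (Σ ℕ λ p → Σ ℕ λ k → Prime p × 1 ≤ k × n ≡ p ℕ.^ k × w ≡ p)
        ⊎ ((¬ IsPrimePower n) × w ≡ 1)

{-# OPTIONS --safe #-}
-- Put u i = 1 - ζⁱ - ζ⁻ⁱ, so that φ_{6n}(1) is the product of u over the i < 3n prime to 6n. Inclusion–exclusion over
-- the primes q ≥ 5 dividing n expresses it through the products P(k), for k ∣ n and ζ replaced by its power of order 6k,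
-- of u over the i < 3k prime to 6; the factor at i = k, which may vanish, is left out, since i = n is not prime to 6n.
-- Up to i ↦ -i the index set of P(k) is the coset {i ≡ 1 mod 6}, and u i = α (1 - α⁻¹ζⁱ)(1 - α⁻¹ζ⁻ⁱ) with α = ζᵏ a
-- primitive sixth root of unity, so ∏_{t<k} (1 - xηᵗ) = 1 - xᵏ with η = ζ⁶ evaluates P(k): it is 1, -3, -2 when
-- gcd(k, 6) is 6, 3, 2, and ±k when k ≡ ±1 mod 6. In particular P(qk)/P(k) is the same for all k in question, whence
-- φ_{6n}(1) is P(n) if no prime q ≥ 5 divides n, P(n)/P(n/q) if exactly one does, and 1 if there are at least two.

module Submission where

open import Defs
open import Level using (Level)
open import Data.Nat as ℕ using (ℕ; zero; suc; _≤_; _<_; s≤s; z≤n)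
import Data.Nat.Properties as ℕₚ
open import Data.Nat.Coprimality using (Coprime; coprime?)
open import Data.Nat.DivMod using (_mod_; m%n<n; m≡m%n+[m/n]*n; %-distribˡ-*; %-distribˡ-+;
  [m+kn]%n≡m%n; m<n⇒m%n≡m; m∣n⇒o%n%m≡o%m)
open import Data.Nat.Divisibility
open import Data.Nat.Primality using (Prime; prime?; prime⇒irreducible; prime⇒nonZero; ¬prime[1]; euclidsLemma)
open import Data.Nat.Primality.Factorisation using (factorise)
open import Data.Nat.ListAction using (product)
open import Data.Nat.Tactic.RingSolver using (solve-∀)
open import Data.Fin using (Fin; toℕ)
import Data.Fin.Properties as Finₚ
open import Data.Integer as ℤ using (ℤ; +_; -[1+_]; _⊖_)
import Data.Integer.Properties as ℤₚ
open import Data.List using (List; []; _∷_; filter; upTo; length)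
open import Data.List.Membership.Propositional using (_∈_)
open import Data.List.Membership.Propositional.Properties using (∈-filter⁺; ∈-filter⁻; ∈-upTo⁺)
open import Data.List.Relation.Unary.All as All using (All; []; _∷_; all?)
open import Data.List.Relation.Unary.Any using (here; there)
open import Data.List.Relation.Unary.Unique.Propositional using (Unique; []; _∷_)
import Data.List.Relation.Unary.Unique.Propositional.Properties as Uniqueₚ
open import Data.Maybe using (Maybe; just; nothing)
open import Data.Product using (∃; _×_; _,_; proj₁; proj₂)
open import Data.Sum using (_⊎_; inj₁; inj₂; [_,_]′)
open import Data.Empty using (⊥-elim)
open import Data.Bool using (if_then_else_; true; false)
open import Function using (_∘_)
open import Relation.Nullary using (¬_; Dec; yes; no; does)
open import Relation.Nullary.Decidable using (_×-dec_; _⊎-dec_; _→-dec_; ¬?; from-yes; toWitness; True)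
open import Relation.Unary using (Decidable)
open import Relation.Binary.PropositionalEquality as ≡ using (_≡_; _≢_)
open import Algebra.Bundles using (CommutativeRing; RawRing)
open import Algebra.Solver.Ring.AlmostCommutativeRing using (fromCommutativeRing; _-Raw-AlmostCommutative⟶_)
import Algebra.Properties.Ring
import Algebra.Properties.AbelianGroup
import Algebra.Solver.Ring
import Relation.Binary.Reasoning.Setoid

-- The obstacle is the factor that is left out. The condition that n does not divide i is therefore
-- carried through the whole sieve, with which it is compatible: qn divides qi exactly when n
-- divides i. For k prime to 6 the product needed runs over t ≠ t₀ and equals 1 + y + ... + y^(k-1)
-- at y = x η^t₀. This must hold at y = 1 too, where it is k, the source of ±k and in the end of
-- v(n); so it is proved by comparing coefficients, not by dividing by 1 - y. The sign of ±k is the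
-- nontrivial character modulo 6, and its multiplicativity makes P(qk)/P(k) equal to ±q for every k
-- prime to 6. As R has no division, the inclusion-exclusion removes one prime at a time by an
-- identity between products, from which a factor is cancelled. That factor is a sieved product at
-- level n/q, known by induction to be a nonzero integer, hence nonzero in characteristic zero.

module Arithmetic where
  open import Data.Nat using (_+_; _*_; _^_; _%_; _/_)
  open import Data.Nat.Properties using (≤-trans; <⇒≤; <⇒≱; *-comm)
  open ≡ using (refl; sym; trans; cong; cong₂; subst; subst₂)

  -- Residues modulo 6 and prime divisors

  IsUnit : ℕ → Set
  IsUnit r = (r ≡ 1) ⊎ (r ≡ 5)

  isUnit? : Decidable IsUnit
  isUnit? r = (r ℕ.≟ 1) ⊎-dec (r ℕ.≟ 5)

  Unit6 : ℕ → Set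
  Unit6 i = IsUnit (i % 6)

  unit6? : Decidable Unit6
  unit6? i = isUnit? (i % 6)

  -- Instances are settled by evaluation: the implicit argument makes the type checker run the
  -- decision over the 36 pairs of residues.
  mod6-finite : (P : ℕ → ℕ → Set) (P? : ∀ r s → Dec (P r s)) →
                {True (Finₚ.all? {n = 6} λ r → Finₚ.all? {n = 6} λ s → P? (toℕ r) (toℕ s))} →
                ∀ a b → P (a % 6) (b % 6)
  mod6-finite P P? {holds} a b = subst₂ P (Finₚ.toℕ-fromℕ< (m%n<n a 6)) (Finₚ.toℕ-fromℕ< (m%n<n b 6))
    (toWitness holds (a mod 6) (b mod 6))

  unit6-* : ∀ a b → Unit6 a → Unit6 b → Unit6 (a * b)
  unit6-* a b ua ub = subst IsUnit (sym (%-distribˡ-* a b 6))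
    (mod6-finite (λ r s → IsUnit r → IsUnit s → IsUnit ((r * s) % 6))
      (λ r s → isUnit? r →-dec isUnit? s →-dec isUnit? ((r * s) % 6))
      a b ua ub)

  unit6-*⁻ʳ : ∀ a b → Unit6 (a * b) → Unit6 b
  unit6-*⁻ʳ a b u =
    mod6-finite (λ r s → IsUnit ((r * s) % 6) → IsUnit s)
      (λ r s → isUnit? ((r * s) % 6) →-dec isUnit? s)
      a b (subst IsUnit (%-distribˡ-* a b 6) u)

  unit6-∣ : ∀ {d n} → d ∣ n → Unit6 n → Unit6 d
  unit6-∣ (divides q refl) = unit6-*⁻ʳ q _

  data Mod6 (n : ℕ) : Set where
    unit   : Unit6 n → Mod6 n
    zero   : n % 6 ≡ 0 → Mod6 n
    even   : (n % 6 ≡ 2) ⊎ (n % 6 ≡ 4) → Mod6 n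
    triple : n % 6 ≡ 3 → Mod6 n

  mod6 : ∀ n → Mod6 n
  mod6 n with n % 6 in eq | m%n<n n 6
  ... | 0 | _ = zero eq
  ... | 1 | _ = unit (inj₁ eq)
  ... | 2 | _ = even (inj₁ eq)
  ... | 3 | _ = triple eq
  ... | 4 | _ = even (inj₂ eq)
  ... | 5 | _ = unit (inj₂ eq)
  ... | suc (suc (suc (suc (suc (suc _))))) | s≤s (s≤s (s≤s (s≤s (s≤s (s≤s ())))))

  ∣-mod6⁺ : ∀ {d n} → d ∣ 6 → d ∣ n → d ∣ n % 6
  ∣-mod6⁺ d∣6 d∣n = %-presˡ-∣ d∣n d∣6

  ∣-mod6⁻ : ∀ {d n r} → d ∣ 6 → n % 6 ≡ r → d ∣ r → d ∣ n
  ∣-mod6⁻ d∣6 eq d∣r = ∣n∣m%n⇒∣m d∣6 (subst (_ ∣_) (sym eq) d∣r)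

  2∣6 : 2 ∣ 6
  2∣6 = divides 3 refl

  3∣6 : 3 ∣ 6
  3∣6 = divides 2 refl

  unit6⇒2∤ : ∀ {n} → Unit6 n → ¬ 2 ∣ n
  unit6⇒2∤ u 2∣n with unit6-∣ 2∣n u
  ... | inj₁ ()
  ... | inj₂ ()

  unit6⇒3∤ : ∀ {n} → Unit6 n → ¬ 3 ∣ n
  unit6⇒3∤ u 3∣n with unit6-∣ 3∣n u
  ... | inj₁ ()
  ... | inj₂ ()

  unit6⇒≥1 : ∀ {n} → Unit6 n → 1 ≤ n
  unit6⇒≥1 {suc n} _ = s≤s z≤n
  unit6⇒≥1 {zero} (inj₁ ())
  unit6⇒≥1 {zero} (inj₂ ())

  prime-∣ : ∀ {p q} → Prime p → Prime q → p ∣ q → p ≡ q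
  prime-∣ pp pq p∣q with prime⇒irreducible pq p∣q
  ... | inj₁ refl = ⊥-elim (¬prime[1] pp)
  ... | inj₂ p≡q  = p≡q

  prime[2] : Prime 2
  prime[2] = from-yes (prime? 2)

  prime[3] : Prime 3
  prime[3] = from-yes (prime? 3)

  prime-mod6 : ∀ {p} → Prime p → Unit6 p ⊎ (p ≡ 2) ⊎ (p ≡ 3)
  prime-mod6 {p} pp with mod6 p
  ... | unit u        = inj₁ u
  ... | zero e        = inj₂ (inj₁ (sym (prime-∣ prime[2] pp (∣-mod6⁻ 2∣6 e (2 ∣0)))))
  ... | even (inj₁ e) = inj₂ (inj₁ (sym (prime-∣ prime[2] pp (∣-mod6⁻ 2∣6 e (divides 1 refl)))))
  ... | even (inj₂ e) = inj₂ (inj₁ (sym (prime-∣ prime[2] pp (∣-mod6⁻ 2∣6 e (divides 2 refl)))))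
  ... | triple e      = inj₂ (inj₂ (sym (prime-∣ prime[3] pp (∣-mod6⁻ 3∣6 e (divides 1 refl)))))

  primeDivisor : ∀ n → 2 ≤ n → ∃ λ p → Prime p × p ∣ n
  primeDivisor n@(suc _) 2≤n with factorise n
  ... | record { factors = []     ; isFactorisation = refl } = ⊥-elim (<⇒≱ 2≤n (s≤s z≤n))
  ... | record { factors = p ∷ ps ; isFactorisation = eq ; factorsPrime = pp ∷ _ } =
        p , pp , subst (p ∣_) (sym eq) (m∣m*n (product ps))

  product-allEqual : ∀ p ps → All Prime ps → (∀ {q} → Prime q → q ∣ product ps → q ≡ p) →
                     product ps ≡ p ^ length ps
  product-allEqual p []       _         h = refl
  product-allEqual p (q ∷ qs) (pq ∷ ps) h =
    cong₂ _*_ (h pq (m∣m*n (product qs))) (product-allEqual p qs ps λ pr r∣ → h pr (∣n⇒∣m*n q r∣))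

  onePrime⇒isPrimePower : ∀ n p → 2 ≤ n → Prime p → (∀ {q} → Prime q → q ∣ n → q ≡ p) → IsPrimePower n
  onePrime⇒isPrimePower n@(suc _) p 2≤n pp h with factorise n
  ... | record { factors = []     ; isFactorisation = refl } = ⊥-elim (<⇒≱ 2≤n (s≤s z≤n))
  ... | record { factors = q ∷ qs ; isFactorisation = eq ; factorsPrime = ps } =
        p , suc (length qs) , pp , s≤s z≤n ,
        trans eq (product-allEqual p (q ∷ qs) ps λ {r} pr r∣ → h pr (subst (r ∣_) (sym eq) r∣))

  prime-∣-^ : ∀ {p q} k → Prime p → Prime q → q ∣ p ^ k → q ≡ p
  prime-∣-^ zero    pp pq q∣1 = ⊥-elim (¬prime[1] (subst Prime (∣1⇒≡1 q∣1) pq))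
  prime-∣-^ {p} (suc k) pp pq q∣ with euclidsLemma p (p ^ k) pq q∣
  ... | inj₁ q∣p  = prime-∣ pq pp q∣p
  ... | inj₂ q∣pᵏ = prime-∣-^ k pp pq q∣pᵏ

  -- Integer values of the base products

  -- The value of ∏ (1 - ζⁱ - ζ⁻ⁱ) for ζ of order 6k over 0 < i < 3k with i prime to 6 and i ≠ k.
  baseMod : ℕ → ℕ → ℤ
  baseMod 0 k = + 1
  baseMod 1 k = + k
  baseMod 2 k = -[1+ 1 ]
  baseMod 3 k = -[1+ 2 ]
  baseMod 4 k = -[1+ 1 ]
  baseMod _ k = ℤ.- (+ k)

  base : ℕ → ℤ
  base k = baseMod (k % 6) k

  -- `ratio n q` stands for the quotient of `base (q * n)` by `base n` when q is prime to 6. The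
  -- last clause covers the n not prime to 6, where a factor q does not change `base`.
  ratioMod : ℕ → ℤ → ℤ
  ratioMod 1 z = z
  ratioMod 5 z = z
  ratioMod _ z = + 1

  ratio : ℕ → ℕ → ℤ
  ratio n q = ratioMod (n % 6) (base q)

  ratio-unit : ∀ n q → Unit6 n → ratio n q ≡ base q
  ratio-unit n q (inj₁ e) rewrite e = refl
  ratio-unit n q (inj₂ e) rewrite e = refl

  ratio-nonunit : ∀ n q → ¬ Unit6 n → ratio n q ≡ + 1
  ratio-nonunit n q ¬u with mod6 n
  ... | unit u                    = ⊥-elim (¬u u)
  ... | zero e           rewrite e = refl
  ... | even (inj₁ e)    rewrite e = refl
  ... | even (inj₂ e)    rewrite e = refl
  ... | triple e         rewrite e = refl

  ratio-* : ∀ q n r → Unit6 q → ratio (q * n) r ≡ ratio n r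
  ratio-* q n r uq with unit6? n
  ... | yes u = trans (ratio-unit (q * n) r (unit6-* q n uq u)) (sym (ratio-unit n r u))
  ... | no ¬u = trans (ratio-nonunit (q * n) r (¬u ∘ unit6-*⁻ʳ q n)) (sym (ratio-nonunit n r ¬u))

  -- For k prime to 6, `base k` is k times the nontrivial character modulo 6, hence multiplicative.
  -- For other k it depends only on gcd(k, 6), which a factor q prime to 6 preserves.
  base-* : ∀ q n → Unit6 q → base (q * n) ≡ ratio n q ℤ.* base n
  base-* q n u = trans (cong (λ r → baseMod r (q * n)) (%-distribˡ-* q n 6)) (cases u)
    where
    cases : Unit6 q → baseMod (((q % 6) * (n % 6)) % 6) (q * n) ≡ ratio n q ℤ.* base n
    cases (inj₁ e) rewrite e with mod6 n
    ... | zero f        rewrite f = refl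
    ... | unit (inj₁ f) rewrite f = ℤₚ.pos-* q n
    ... | unit (inj₂ f) rewrite f = trans (cong ℤ.-_ (ℤₚ.pos-* q n)) (ℤₚ.neg-distribʳ-* (+ q) (+ n))
    ... | even (inj₁ f) rewrite f = refl
    ... | even (inj₂ f) rewrite f = refl
    ... | triple f      rewrite f = refl
    cases (inj₂ e) rewrite e with mod6 n
    ... | zero f        rewrite f = refl
    ... | unit (inj₁ f) rewrite f = trans (cong ℤ.-_ (ℤₚ.pos-* q n)) (ℤₚ.neg-distribˡ-* (+ q) (+ n))
    ... | unit (inj₂ f) rewrite f = trans (ℤₚ.pos-* q n)
          (trans (sym (ℤₚ.neg-involutive _)) (trans (cong ℤ.-_ (ℤₚ.neg-distribˡ-* (+ q) (+ n)))
                                                    (ℤₚ.neg-distribʳ-* (ℤ.- (+ q)) (+ n))))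
    ... | even (inj₁ f) rewrite f = refl
    ... | even (inj₂ f) rewrite f = refl
    ... | triple f      rewrite f = refl

  base≢0 : ∀ n → 1 ≤ n → base n ≢ + 0
  base≢0 n@(suc _) _ with mod6 n
  ... | zero f        rewrite f = λ ()
  ... | unit (inj₁ f) rewrite f = λ ()
  ... | unit (inj₂ f) rewrite f = λ ()
  ... | even (inj₁ f) rewrite f = λ ()
  ... | even (inj₂ f) rewrite f = λ ()
  ... | triple f      rewrite f = λ ()

  ratio≢0 : ∀ n q → 1 ≤ q → ratio n q ≢ + 0
  ratio≢0 n q 1≤q with unit6? n
  ... | yes u = λ eq → base≢0 q 1≤q (trans (sym (ratio-unit n q u)) eq)
  ... | no ¬u = λ eq → 1≢0 (trans (sym (ratio-nonunit n q ¬u)) eq)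
    where
    1≢0 : + 1 ≢ + 0
    1≢0 ()

  -- The sieve by the primes from 5 on

  -- Among the i < 3n prime to 6, n ∣ i only for i = n, where 1 - ζⁱ - ζ⁻ⁱ may vanish.
  Survives : ℕ → List ℕ → ℕ → Set
  Survives n qs i = Unit6 i × (¬ n ∣ i) × All (λ q → ¬ q ∣ i) qs

  survives? : ∀ n qs → Decidable (Survives n qs)
  survives? n qs i = unit6? i ×-dec ¬? (n ∣? i) ×-dec all? (λ q → ¬? (q ∣? i)) qs

  survives-*⁻ : ∀ q n qs i → Survives (q * n) qs (q * i) → Survives n qs i
  survives-*⁻ q n qs i (u , n∤ , qs∤) =
    unit6-*⁻ʳ q i u , n∤ ∘ *-monoʳ-∣ q , All.map (_∘ ∣n⇒∣m*n q) qs∤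

  -- Here q must differ from the primes in `qs`: only then does r ∣ q * i force r ∣ i.
  survives-*⁺ : ∀ q n qs i → Prime q → Unit6 q → All Prime qs → All (q ≢_) qs →
                Survives n qs i → Survives (q * n) qs (q * i)
  survives-*⁺ q n qs i pq uq pqs q∉qs (u , n∤ , qs∤) =
    unit6-* q i uq u , n∤ ∘ *-cancelˡ-∣ q {{prime⇒nonZero pq}} , go pqs q∉qs qs∤
    where
    go : ∀ {rs} → All Prime rs → All (q ≢_) rs → All (λ r → ¬ r ∣ i) rs → All (λ r → ¬ r ∣ q * i) rs
    go []         []          []       = []
    go (pr ∷ prs) (q≢r ∷ q∉) (r∤ ∷ rs∤) =
      (λ r∣qi → [ (λ r∣q → q≢r (sym (prime-∣ pr pq r∣q))) , r∤ ]′ (euclidsLemma q i pr r∣qi)) ∷ go prs q∉ rs∤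

  -- A prime at least 5 is encoded as a prime that is a unit modulo 6, the form in which the sieve
  -- and `base-*` use it.
  unitPrimeDivisor? : ∀ n → Decidable (λ q → Prime q × Unit6 q × q ∣ n)
  unitPrimeDivisor? n q = prime? q ×-dec unit6? q ×-dec (q ∣? n)

  unitPrimes : ℕ → List ℕ
  unitPrimes n = filter (unitPrimeDivisor? n) (upTo (suc n))

  unitPrimes-unique : ∀ n → Unique (unitPrimes n)
  unitPrimes-unique n = Uniqueₚ.filter⁺ (unitPrimeDivisor? n) (Uniqueₚ.upTo⁺ (suc n))

  ∈-unitPrimes⁻ : ∀ {n q} → q ∈ unitPrimes n → Prime q × Unit6 q × q ∣ n
  ∈-unitPrimes⁻ {n} q∈ = proj₂ (∈-filter⁻ (unitPrimeDivisor? n) {xs = upTo (suc n)} q∈)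

  ∈-unitPrimes⁺ : ∀ {n q} → 1 ≤ n → Prime q → Unit6 q → q ∣ n → q ∈ unitPrimes n
  ∈-unitPrimes⁺ {n@(suc _)} _ pq uq q∣n = ∈-filter⁺ (unitPrimeDivisor? n) (∈-upTo⁺ (s≤s (∣⇒≤ q∣n))) (pq , uq , q∣n)

  coprime⇒survives : ∀ n i → 2 ≤ n → Coprime i (6 * n) → Survives n (unitPrimes n) i
  coprime⇒survives n i 2≤n cop = uniti , n∤i , All.tabulate q∤i
    where
    6∣ : ∀ {d} → d ∣ 6 → d ∣ 6 * n
    6∣ = ∣m⇒∣m*n n
    uniti : Unit6 i
    uniti with mod6 i
    ... | unit u = u
    ... | zero e with cop (∣-mod6⁻ 2∣6 e (2 ∣0) , 6∣ 2∣6)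
    ...   | ()
    uniti | even (inj₁ e) with cop (∣-mod6⁻ 2∣6 e (divides 1 refl) , 6∣ 2∣6)
    ...   | ()
    uniti | even (inj₂ e) with cop (∣-mod6⁻ 2∣6 e (divides 2 refl) , 6∣ 2∣6)
    ...   | ()
    uniti | triple e with cop (∣-mod6⁻ 3∣6 e (divides 1 refl) , 6∣ 3∣6)
    ...   | ()
    n∤i : ¬ n ∣ i
    n∤i n∣i = ℕₚ.<⇒≢ 2≤n (sym (cop (n∣i , n∣m*n 6)))
    q∤i : ∀ {q} → q ∈ unitPrimes n → ¬ q ∣ i
    q∤i q∈ q∣i with ∈-unitPrimes⁻ {n} q∈
    ... | pq , _ , q∣n = ¬prime[1] (subst Prime (cop (q∣i , ∣n⇒∣m*n 6 q∣n)) pq)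

  -- A common divisor other than 1 has a prime factor p, which divides 6 or n. As a divisor of i it
  -- is prime to 6, so it belongs to `unitPrimes n`, and the sieve has removed its multiples.
  survives⇒coprime : ∀ n i → 2 ≤ n → Survives n (unitPrimes n) i → Coprime i (6 * n)
  survives⇒coprime n i 2≤n (u , _ , qs∤) {d} (d∣i , d∣6n) with d ℕ.≟ 1
  ... | yes d≡1 = d≡1
  ... | no d≢1 with primeDivisor d (ℕₚ.≤∧≢⇒< (unit6⇒≥1 (unit6-∣ d∣i u)) (d≢1 ∘ sym))
  ...   | p , pp , p∣d with unit6-∣ (∣-trans p∣d d∣i) u | euclidsLemma 6 n pp (∣-trans p∣d d∣6n)
  ...     | up | inj₂ p∣n = ⊥-elim (All.lookup qs∤ (∈-unitPrimes⁺ (<⇒≤ 2≤n) pp up p∣n) (∣-trans p∣d d∣i))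
  ...     | up | inj₁ p∣6 with euclidsLemma 2 3 pp p∣6
  ...       | inj₁ p∣2 = ⊥-elim (unit6⇒2∤ up (∣-reflexive (sym (prime-∣ pp prime[2] p∣2))))
  ...       | inj₂ p∣3 = ⊥-elim (unit6⇒3∤ up (∣-reflexive (sym (prime-∣ pp prime[3] p∣3))))

  -- Integer values of the sieved products

  -- The value of the same product over the i that moreover are prime to all q ∈ qs, for distinct primes q ≥ 5 dividing n.
  value : ℕ → List ℕ → ℤ
  value n []          = base n
  value n (q ∷ [])    = ratio n q
  value n (_ ∷ _ ∷ _) = + 1

  -- The integer counterpart of `sieved-∷`. With one prime r already in the list, the new factor is
  -- 1 because `ratio` does not change when n is multiplied by q.
  value-* : ∀ q n qs → Unit6 q → value (q * n) qs ≡ value (q * n) (q ∷ qs) ℤ.* value n qs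
  value-* q n []          uq = trans (base-* q n uq) (cong (ℤ._* base n) (sym (ratio-* q n q uq)))
  value-* q n (r ∷ [])    uq = trans (ratio-* q n r uq) (sym (ℤₚ.*-identityˡ _))
  value-* q n (_ ∷ _ ∷ _) uq = refl

  value≢0 : ∀ n qs → 1 ≤ n → All Unit6 qs → value n qs ≢ + 0
  value≢0 n []          1≤n _        = base≢0 n 1≤n
  value≢0 n (q ∷ [])    _   (uq ∷ _) = ratio≢0 n q (unit6⇒≥1 uq)
  value≢0 n (_ ∷ _ ∷ _) _   _        ()

  -- For p ≥ 5 the sieving list consists of p alone and p ^ k is prime to 6, which leaves `base p`.
  -- For p = 2 and p = 3 the list is empty, and `base` takes one value on all powers of p.
  value-primePower : ∀ p k → Prime p → 1 ≤ k → value (p ^ k) (unitPrimes (p ^ k)) ≡ base p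
  value-primePower p k@(suc k′) pp _ with prime-mod6 pp
  ... | inj₁ up = go (unitPrimes n) (unitPrimes-unique n) (∈-unitPrimes⁻ {n})
                     (∈-unitPrimes⁺ (unit6⇒≥1 (un k)) pp up (m∣m*n (p ^ k′)))
    where
    n = p ^ k
    un : ∀ j → Unit6 (p ^ j)
    un zero    = inj₁ refl
    un (suc j) = unit6-* p (p ^ j) up (un j)
    go : ∀ qs → Unique qs → (∀ {q} → q ∈ qs → Prime q × Unit6 q × q ∣ n) → p ∈ qs → value n qs ≡ base p
    go (q ∷ [])     _ h (here refl) = ratio-unit n p (un k)
    go (q ∷ r ∷ qs) ((q≢r ∷ _) ∷ _) h _ with h (here refl) | h (there (here refl))
    ... | pq , _ , q∣n | pr , _ , r∣n = ⊥-elim (q≢r (trans (prime-∣-^ k pp pq q∣n) (sym (prime-∣-^ k pp pr r∣n))))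
  ... | inj₂ 2or3 = trans (cong (value n) (noUnit (unitPrimes n) (∈-unitPrimes⁻ {n}))) (small 2or3)
    where
    n = p ^ k
    noUnit : ∀ qs → (∀ {q} → q ∈ qs → Prime q × Unit6 q × q ∣ n) → qs ≡ []
    noUnit []       h = refl
    noUnit (q ∷ qs) h with h (here refl)
    ... | pq , uq , q∣n = ⊥-elim (nonUnit 2or3 (subst Unit6 (prime-∣-^ k pp pq q∣n) uq))
      where
      nonUnit : (p ≡ 2) ⊎ (p ≡ 3) → ¬ Unit6 p
      nonUnit (inj₁ refl) up = unit6⇒2∤ up ∣-refl
      nonUnit (inj₂ refl) up = unit6⇒3∤ up ∣-refl
    powers-of-2 : ∀ j → ((2 ^ suc j) % 6 ≡ 2) ⊎ ((2 ^ suc j) % 6 ≡ 4)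
    powers-of-2 zero    = inj₁ refl
    powers-of-2 (suc j) with powers-of-2 j
    ... | inj₁ e = inj₂ (trans (%-distribˡ-* 2 (2 ^ suc j) 6) (cong (λ r → (2 * r) % 6) e))
    ... | inj₂ e = inj₁ (trans (%-distribˡ-* 2 (2 ^ suc j) 6) (cong (λ r → (2 * r) % 6) e))
    powers-of-3 : ∀ j → (3 ^ suc j) % 6 ≡ 3
    powers-of-3 zero    = refl
    powers-of-3 (suc j) = trans (%-distribˡ-* 3 (3 ^ suc j) 6) (cong (λ r → (3 * r) % 6) (powers-of-3 j))
    small : (p ≡ 2) ⊎ (p ≡ 3) → base n ≡ base p
    small (inj₁ refl) with powers-of-2 k′
    ... | inj₁ e rewrite e = refl
    ... | inj₂ e rewrite e = refl
    small (inj₂ refl) rewrite powers-of-3 k′ = refl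

  -- With no prime factor from 5 on, n is divisible by both 2 and 3, and `base` is 1 at multiples of
  -- 6. With exactly one such prime q, n cannot be prime to 6, or it would be a power of q; so the
  -- ratio is 1.
  value-notPrimePower : ∀ n → 3 ≤ n → ¬ IsPrimePower n → value n (unitPrimes n) ≡ + 1
  value-notPrimePower n 3≤n ¬pp = go (unitPrimes n) (∈-unitPrimes⁺ (≤-trans (s≤s z≤n) 3≤n)) (∈-unitPrimes⁻ {n})
    where
    2≤n : 2 ≤ n
    2≤n = <⇒≤ 3≤n
    module _ (complete : ∀ {q} → Prime q → Unit6 q → q ∣ n → q ∈ []) where
      only2 : ¬ 3 ∣ n → IsPrimePower n
      only2 3∤n = onePrime⇒isPrimePower n 2 2≤n prime[2] λ pq q∣n → case (prime-mod6 pq) pq q∣n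
        where
        case : ∀ {q} → Unit6 q ⊎ (q ≡ 2) ⊎ (q ≡ 3) → Prime q → q ∣ n → q ≡ 2
        case (inj₁ u)           pq q∣n with complete pq u q∣n
        ... | ()
        case (inj₂ (inj₁ refl)) _  _   = refl
        case (inj₂ (inj₂ refl)) _  3∣n = ⊥-elim (3∤n 3∣n)
      only3 : ¬ 2 ∣ n → IsPrimePower n
      only3 2∤n = onePrime⇒isPrimePower n 3 2≤n prime[3] λ pq q∣n → case (prime-mod6 pq) pq q∣n
        where
        case : ∀ {q} → Unit6 q ⊎ (q ≡ 2) ⊎ (q ≡ 3) → Prime q → q ∣ n → q ≡ 3
        case (inj₁ u)           pq q∣n with complete pq u q∣n
        ... | ()
        case (inj₂ (inj₁ refl)) _  2∣n = ⊥-elim (2∤n 2∣n)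
        case (inj₂ (inj₂ refl)) _  _   = refl
    go : ∀ qs → (∀ {q} → Prime q → Unit6 q → q ∣ n → q ∈ qs) → (∀ {q} → q ∈ qs → Prime q × Unit6 q × q ∣ n) →
         value n qs ≡ + 1
    go [] complete sound with mod6 n
    ... | zero e rewrite e = refl
    ... | even e = ⊥-elim (¬pp (only2 complete λ 3∣n → 3∤r e (∣-mod6⁺ 3∣6 3∣n)))
      where
      3∤r : ∀ {r} → (r ≡ 2) ⊎ (r ≡ 4) → ¬ 3 ∣ r
      3∤r (inj₁ refl) = from-yes (¬? (3 ∣? 2))
      3∤r (inj₂ refl) = from-yes (¬? (3 ∣? 4))
    ... | triple e = ⊥-elim (¬pp (only3 complete λ 2∣n → from-yes (¬? (2 ∣? 3)) (subst (2 ∣_) e (∣-mod6⁺ 2∣6 2∣n))))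
    ... | unit u with primeDivisor n 2≤n
    ...   | p , pp , p∣n with complete pp (unit6-∣ p∣n u) p∣n
    ...     | ()
    go (q ∷ []) complete sound with unit6? n
    ... | no ¬u = ratio-nonunit n q ¬u
    ... | yes u = ⊥-elim (¬pp (onePrime⇒isPrimePower n q 2≤n (proj₁ (sound (here refl)))
                    λ pr r∣n → only (complete pr (unit6-∣ r∣n u) r∣n)))
      where
      only : ∀ {r} → r ∈ q ∷ [] → r ≡ q
      only (here e) = e
    go (_ ∷ _ ∷ _) _ _ = refl

  mod3-of-mod6 : ∀ w {r} → w % 6 ≡ r → w % 3 ≡ r % 3
  mod3-of-mod6 w refl = sym (m∣n⇒o%n%m≡o%m 3 6 w 3∣6)

  -- For a prime from 5 on, the residue modulo 3 determines the one modulo 6, so the sign of `base`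
  -- turns into a condition modulo 3.
  base-prime⁺ : ∀ p → Prime p → p % 3 ≡ 1 → base p ≡ + p
  base-prime⁺ p pp p%3 with prime-mod6 pp
  ... | inj₁ (inj₁ e) rewrite e = refl
  ... | inj₁ (inj₂ e) with trans (sym p%3) (mod3-of-mod6 p e)
  ...   | ()
  base-prime⁺ p pp () | inj₂ (inj₁ refl)
  base-prime⁺ p pp () | inj₂ (inj₂ refl)

  base-prime⁻ : ∀ p → Prime p → (p % 3 ≡ 2) ⊎ (p ≡ 2) ⊎ (p ≡ 3) → base p ≡ ℤ.- (+ p)
  base-prime⁻ p pp (inj₂ (inj₁ refl)) = refl
  base-prime⁻ p pp (inj₂ (inj₂ refl)) = refl
  base-prime⁻ p pp (inj₁ p%3) with prime-mod6 pp
  ... | inj₁ (inj₂ e) rewrite e = refl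
  ... | inj₁ (inj₁ e) with trans (sym p%3) (mod3-of-mod6 p e)
  ...   | ()
  base-prime⁻ p pp (inj₁ p%3) | inj₂ (inj₁ refl) = refl
  base-prime⁻ p pp (inj₁ p%3) | inj₂ (inj₂ refl) = refl

  value-v : ∀ n w → 3 ≤ n → IsV n w →
            (w % 3 ≡ 1 → value n (unitPrimes n) ≡ + w) ×
            ((w % 3 ≡ 2) ⊎ (w ≡ 2) ⊎ (w ≡ 3) → value n (unitPrimes n) ≡ ℤ.- (+ w))
  value-v n w 3≤n (inj₁ (p , k , pp , 1≤k , refl , refl)) =
    (λ h → trans (value-primePower p k pp 1≤k) (base-prime⁺ p pp h)) ,
    (λ h → trans (value-primePower p k pp 1≤k) (base-prime⁻ p pp h))
  value-v n w 3≤n (inj₂ (¬pp , refl)) =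
    (λ _ → value-notPrimePower n 3≤n ¬pp) ,
    λ { (inj₁ ()) ; (inj₂ (inj₁ ())) ; (inj₂ (inj₂ ())) }

  -- 6 t₀ + 1 is whichever of k and 5k is congruent to 1 modulo 6.
  excludedIndex : ∀ k → Unit6 k → ∃ λ t₀ → t₀ < k × 6 * t₀ + 1 ≡ k * (k % 6) ×
                  (∀ t → t < k → k ∣ 6 * t + 1 → t ≡ t₀)
  excludedIndex k u = t₀ , t₀<k , eq , unique
    where
    s = k / 6
    k≡ : ∀ {r} → k % 6 ≡ r → k ≡ r + s * 6
    k≡ e = trans (m≡m%n+[m/n]*n k 6) (cong (_+ s * 6) e)
    exists : Unit6 k → ∃ λ t → t < k × 6 * t + 1 ≡ k * (k % 6)
    exists (inj₁ e) = s , subst (s <_) (sym (k≡ e)) (s≤s (ℕₚ.m≤m*n s 6)) ,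
      trans (arith s) (cong₂ _*_ (sym (k≡ e)) (sym e))
      where
      arith : ∀ s → 6 * s + 1 ≡ (1 + s * 6) * 1
      arith = solve-∀
    -- For k ≡ 5 the index k lies outside the coset of 1. Its reflection 6k - k = 5k takes its
    -- place, and 5(6s + 5) = 6(4 + 5s) + 1.
    exists (inj₂ e) = 4 + 5 * s ,
      subst (4 + 5 * s <_) (sym (k≡ e)) (subst (5 + 5 * s ≤_) (arith′ s) (ℕₚ.m≤m+n (5 + 5 * s) s)) ,
      trans (arith s) (cong₂ _*_ (sym (k≡ e)) (sym e))
      where
      arith : ∀ s → 6 * (4 + 5 * s) + 1 ≡ (5 + s * 6) * 5
      arith = solve-∀
      arith′ : ∀ s → 5 + 5 * s + s ≡ 5 + s * 6
      arith′ = solve-∀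
    t₀ = proj₁ (exists u)
    t₀<k = proj₁ (proj₂ (exists u))
    eq = proj₂ (proj₂ (exists u))
    unique : ∀ t → t < k → k ∣ 6 * t + 1 → t ≡ t₀
    unique t t<k (divides q 6t+1≡qk) = ℕₚ.*-cancelˡ-≡ t t₀ 6 (ℕₚ.+-cancelʳ-≡ 1 (6 * t) (6 * t₀)
      (trans 6t+1≡qk (trans (cong (_* k) q≡) (trans (*-comm (k % 6) k) (sym eq)))))
      where
      6t+1<6k : 6 * t + 1 < 6 * k
      6t+1<6k = ≤-trans (subst (_≤ 6 * t + 6) (ℕₚ.+-suc (6 * t) 1) (ℕₚ.+-monoʳ-≤ (6 * t) (s≤s (s≤s z≤n))))
                        (subst (_≤ 6 * k) (trans (ℕₚ.*-suc 6 t) (ℕₚ.+-comm 6 (6 * t))) (ℕₚ.*-monoʳ-≤ 6 t<k))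
      q<6 : q < 6
      q<6 = ℕₚ.*-cancelʳ-< k q 6 (subst (_< 6 * k) 6t+1≡qk 6t+1<6k)
      residue : (6 * t + 1) % 6 ≡ 1
      residue = trans (cong (_% 6) (trans (ℕₚ.+-comm (6 * t) 1) (cong suc (*-comm 6 t)))) ([m+kn]%n≡m%n 1 t 6)
      -- Every unit modulo 6 is its own inverse, so q * k ≡ 1 with q < 6 leaves only the residue of
      -- k.
      q≡ : q ≡ k % 6
      q≡ = trans (sym (m<n⇒m%n≡m q<6))
        (mod6-finite (λ r s → (r * s) % 6 ≡ 1 → r ≡ s)
          (λ r s → ((r * s) % 6 ℕ.≟ 1) →-dec (r ℕ.≟ s))
          q k (trans (sym (%-distribˡ-* q k 6)) (trans (cong (_% 6) (sym 6t+1≡qk)) residue)))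

open Arithmetic

module OverRing {c ℓ : Level} (R : CommutativeRing c ℓ) where
  open CommutativeRing R hiding (zero)
  open Algebra.Properties.Ring ring
  open Algebra.Properties.AbelianGroup +-abelianGroup using (⁻¹-∙-comm)
  open Relation.Binary.Reasoning.Setoid setoid

  -- The integers in R and the ring solver

  infixr 8 _^_
  _^_ : Carrier → ℕ → Carrier
  _^_ = pow R

  fromℤ : ℤ → Carrier
  fromℤ (+ n)    = fromℕ R n
  fromℤ -[1+ n ] = - fromℕ R (suc n)

  fromℕ-+ : ∀ m n → fromℕ R (m ℕ.+ n) ≈ fromℕ R m + fromℕ R n
  fromℕ-+ zero    n = sym (+-identityˡ _)
  fromℕ-+ (suc m) n = trans (+-congˡ (fromℕ-+ m n)) (sym (+-assoc _ _ _))

  fromℕ-* : ∀ m n → fromℕ R (m ℕ.* n) ≈ fromℕ R m * fromℕ R n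
  fromℕ-* zero    n = sym (zeroˡ _)
  fromℕ-* (suc m) n = begin
    fromℕ R (n ℕ.+ m ℕ.* n)                  ≈⟨ fromℕ-+ n (m ℕ.* n) ⟩
    fromℕ R n + fromℕ R (m ℕ.* n)            ≈⟨ +-cong (sym (*-identityˡ _)) (fromℕ-* m n) ⟩
    1# * fromℕ R n + fromℕ R m * fromℕ R n   ≈⟨ distribʳ _ _ _ ⟨
    (1# + fromℕ R m) * fromℕ R n             ∎

  fromℤ-⊖ : ∀ m n → fromℤ (m ⊖ n) ≈ fromℕ R m - fromℕ R n
  fromℤ-⊖ m       zero    = sym (trans (+-congˡ -0#≈0#) (+-identityʳ _))
  fromℤ-⊖ zero    (suc n) = sym (+-identityˡ _)
  fromℤ-⊖ (suc m) (suc n) = begin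
    fromℤ (suc m ⊖ suc n)                           ≡⟨ ≡.cong fromℤ (ℤₚ.[1+m]⊖[1+n]≡m⊖n m n) ⟩
    fromℤ (m ⊖ n)                                   ≈⟨ fromℤ-⊖ m n ⟩
    fromℕ R m - fromℕ R n                           ≈⟨ +-identityˡ _ ⟨
    0# + (fromℕ R m - fromℕ R n)                    ≈⟨ +-congʳ (-‿inverseʳ 1#) ⟨
    (1# - 1#) + (fromℕ R m - fromℕ R n)             ≈⟨ +-assoc _ _ _ ⟩
    1# + (- 1# + (fromℕ R m - fromℕ R n))           ≈⟨ +-congˡ (+-assoc _ _ _) ⟨
    1# + ((- 1# + fromℕ R m) - fromℕ R n)           ≈⟨ +-congˡ (+-congʳ (+-comm _ _)) ⟩
    1# + ((fromℕ R m - 1#) - fromℕ R n)             ≈⟨ +-congˡ (+-assoc _ _ _) ⟩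
    1# + (fromℕ R m + (- 1# - fromℕ R n))           ≈⟨ +-assoc _ _ _ ⟨
    (1# + fromℕ R m) + (- 1# - fromℕ R n)           ≈⟨ +-congˡ (⁻¹-∙-comm _ _) ⟩
    (1# + fromℕ R m) - (1# + fromℕ R n)             ∎

  fromℤ-neg : ∀ i → fromℤ (ℤ.- i) ≈ - fromℤ i
  fromℤ-neg (+ zero)  = sym -0#≈0#
  fromℤ-neg (+ suc n) = refl
  fromℤ-neg -[1+ n ]  = sym (-‿involutive _)

  fromℤ-+ : ∀ i j → fromℤ (i ℤ.+ j) ≈ fromℤ i + fromℤ j
  fromℤ-+ (+ m)    (+ n)    = fromℕ-+ m n
  fromℤ-+ (+ m)    -[1+ n ] = fromℤ-⊖ m (suc n)
  fromℤ-+ -[1+ m ] (+ n)    = trans (fromℤ-⊖ n (suc m)) (+-comm _ _)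
  fromℤ-+ -[1+ m ] -[1+ n ] = begin
    - fromℕ R (suc (suc (m ℕ.+ n)))           ≡⟨ ≡.cong (λ k → - fromℕ R (suc k)) (ℕₚ.+-suc m n) ⟨
    - fromℕ R (suc m ℕ.+ suc n)               ≈⟨ -‿cong (fromℕ-+ (suc m) (suc n)) ⟩
    - (fromℕ R (suc m) + fromℕ R (suc n))     ≈⟨ ⁻¹-∙-comm _ _ ⟨
    - fromℕ R (suc m) - fromℕ R (suc n)       ∎

  fromℤ-*ˡ : ∀ m j → fromℤ (+ m ℤ.* j) ≈ fromℕ R m * fromℤ j
  fromℤ-*ˡ m (+ n) = trans (reflexive (≡.cong fromℤ (≡.sym (ℤₚ.pos-* m n)))) (fromℕ-* m n)
  fromℤ-*ˡ m -[1+ n ] = begin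
    fromℤ (+ m ℤ.* (ℤ.- (+ suc n)))     ≡⟨ ≡.cong fromℤ (ℤₚ.neg-distribʳ-* (+ m) (+ suc n)) ⟨
    fromℤ (ℤ.- (+ m ℤ.* + suc n))       ≈⟨ fromℤ-neg (+ m ℤ.* + suc n) ⟩
    - fromℤ (+ m ℤ.* + suc n)           ≈⟨ -‿cong (fromℤ-*ˡ m (+ suc n)) ⟩
    - (fromℕ R m * fromℕ R (suc n))     ≈⟨ -‿distribʳ-* _ _ ⟩
    fromℕ R m * - fromℕ R (suc n)       ∎

  fromℤ-* : ∀ i j → fromℤ (i ℤ.* j) ≈ fromℤ i * fromℤ j
  fromℤ-* (+ m) j = fromℤ-*ˡ m j
  fromℤ-* -[1+ m ] j = begin
    fromℤ ((ℤ.- (+ suc m)) ℤ.* j)       ≡⟨ ≡.cong fromℤ (ℤₚ.neg-distribˡ-* (+ suc m) j) ⟨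
    fromℤ (ℤ.- (+ suc m ℤ.* j))         ≈⟨ fromℤ-neg (+ suc m ℤ.* j) ⟩
    - fromℤ (+ suc m ℤ.* j)             ≈⟨ -‿cong (fromℤ-*ˡ (suc m) j) ⟩
    - (fromℕ R (suc m) * fromℤ j)       ≈⟨ -‿distribˡ-* _ _ ⟩
    - fromℕ R (suc m) * fromℤ j         ∎

  ℤ-rawRing : RawRing _ _
  ℤ-rawRing = record
    { Carrier = ℤ ; _≈_ = _≡_ ; _+_ = ℤ._+_ ; _*_ = ℤ._*_ ; -_ = ℤ.-_ ; 0# = + 0 ; 1# = + 1 }

  -- fromℤ (+ 1) is 1# + 0#; the solver must send its constant 1 to 1# itself.
  ⟦_⟧ : ℤ → Carrier
  ⟦ + 1 ⟧ = 1#
  ⟦ i ⟧   = fromℤ i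

  ⟦⟧≈fromℤ : ∀ i → ⟦ i ⟧ ≈ fromℤ i
  ⟦⟧≈fromℤ (+ 0)             = refl
  ⟦⟧≈fromℤ (+ 1)             = sym (+-identityʳ _)
  ⟦⟧≈fromℤ (+ suc (suc n))   = refl
  ⟦⟧≈fromℤ -[1+ n ]          = refl

  ⟦⟧-morphism : ℤ-rawRing -Raw-AlmostCommutative⟶ fromCommutativeRing R
  ⟦⟧-morphism = record
    { ⟦_⟧    = ⟦_⟧
    ; +-homo = λ i j → trans (⟦⟧≈fromℤ (i ℤ.+ j)) (trans (fromℤ-+ i j) (sym (+-cong (⟦⟧≈fromℤ i) (⟦⟧≈fromℤ j))))
    ; *-homo = λ i j → trans (⟦⟧≈fromℤ (i ℤ.* j)) (trans (fromℤ-* i j) (sym (*-cong (⟦⟧≈fromℤ i) (⟦⟧≈fromℤ j))))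
    ; -‿homo = λ i → trans (⟦⟧≈fromℤ (ℤ.- i)) (trans (fromℤ-neg i) (sym (-‿cong (⟦⟧≈fromℤ i))))
    ; 0-homo = refl
    ; 1-homo = refl
    }

  coeff≟ : ∀ i j → Maybe (⟦ i ⟧ ≈ ⟦ j ⟧)
  coeff≟ i j with i ℤ.≟ j
  ... | yes i≡j = just (reflexive (≡.cong ⟦_⟧ i≡j))
  ... | no  _   = nothing

  open Algebra.Solver.Ring ℤ-rawRing (fromCommutativeRing R) ⟦⟧-morphism coeff≟
    using (solve; con; _:+_; _:*_; _:-_; :-_; _:=_)

  -- Powers, finite products and sums

  ^-congˡ : ∀ {x y} n → x ≈ y → x ^ n ≈ y ^ n
  ^-congˡ zero    x≈y = refl
  ^-congˡ (suc n) x≈y = *-cong x≈y (^-congˡ n x≈y)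

  ^-+ : ∀ x m n → x ^ (m ℕ.+ n) ≈ x ^ m * x ^ n
  ^-+ x zero    n = sym (*-identityˡ _)
  ^-+ x (suc m) n = trans (*-congˡ (^-+ x m n)) (sym (*-assoc _ _ _))

  1^ : ∀ n → 1# ^ n ≈ 1#
  1^ zero    = refl
  1^ (suc n) = trans (*-identityˡ _) (1^ n)

  *-^ : ∀ x y n → (x * y) ^ n ≈ x ^ n * y ^ n
  *-^ x y zero    = sym (*-identityˡ _)
  *-^ x y (suc n) = trans (*-congˡ (*-^ x y n))
    (solve 4 (λ x y a b → (x :* y) :* (a :* b) := (x :* a) :* (y :* b)) refl x y _ _)

  ^-* : ∀ x m n → x ^ (m ℕ.* n) ≈ (x ^ m) ^ n
  ^-* x zero    n = sym (1^ n)
  ^-* x (suc m) n = begin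
    x ^ (n ℕ.+ m ℕ.* n)     ≈⟨ ^-+ x n (m ℕ.* n) ⟩
    x ^ n * x ^ (m ℕ.* n)   ≈⟨ *-congˡ (^-* x m n) ⟩
    x ^ n * (x ^ m) ^ n     ≈⟨ *-^ _ _ n ⟨
    (x * x ^ m) ^ n         ∎

  ^-period : ∀ {x} d → x ^ d ≈ 1# → ∀ r s → x ^ (r ℕ.+ s ℕ.* d) ≈ x ^ r
  ^-period {x} d xᵈ≈1 r s = begin
    x ^ (r ℕ.+ s ℕ.* d)      ≡⟨ ≡.cong (λ k → x ^ (r ℕ.+ k)) (ℕₚ.*-comm s d) ⟩
    x ^ (r ℕ.+ d ℕ.* s)      ≈⟨ ^-+ x r (d ℕ.* s) ⟩
    x ^ r * x ^ (d ℕ.* s)    ≈⟨ *-congˡ (^-* x d s) ⟩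
    x ^ r * (x ^ d) ^ s      ≈⟨ *-congˡ (trans (^-congˡ s xᵈ≈1) (1^ s)) ⟩
    x ^ r * 1#               ≈⟨ *-identityʳ _ ⟩
    x ^ r                    ∎

  ∏ : ℕ → (ℕ → Carrier) → Carrier
  ∏ zero    f = 1#
  ∏ (suc n) f = f n * ∏ n f

  ∑ : ℕ → (ℕ → Carrier) → Carrier
  ∑ zero    f = 0#
  ∑ (suc n) f = f n + ∑ n f

  ∏-cong : ∀ n {f g} → (∀ i → i < n → f i ≈ g i) → ∏ n f ≈ ∏ n g
  ∏-cong zero    h = refl
  ∏-cong (suc n) h = *-cong (h n ℕₚ.≤-refl) (∏-cong n (λ i i<n → h i (ℕₚ.m<n⇒m<1+n i<n)))

  ∏-* : ∀ n f g → ∏ n (λ i → f i * g i) ≈ ∏ n f * ∏ n g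
  ∏-* zero    f g = sym (*-identityˡ _)
  ∏-* (suc n) f g = trans (*-congˡ (∏-* n f g))
    (solve 4 (λ x y a b → (x :* y) :* (a :* b) := (x :* a) :* (y :* b)) refl _ _ _ _)

  ∏-const : ∀ n x → ∏ n (λ _ → x) ≈ x ^ n
  ∏-const zero    x = refl
  ∏-const (suc n) x = *-congˡ (∏-const n x)

  ∏-1 : ∀ n {f} → (∀ i → i < n → f i ≈ 1#) → ∏ n f ≈ 1#
  ∏-1 n h = trans (∏-cong n h) (trans (∏-const n 1#) (1^ n))

  ∏-+ : ∀ m n f → ∏ (m ℕ.+ n) f ≈ ∏ m f * ∏ n (λ i → f (m ℕ.+ i))
  ∏-+ m zero    f = trans (reflexive (≡.cong (λ k → ∏ k f) (ℕₚ.+-identityʳ m))) (sym (*-identityʳ _))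
  ∏-+ m (suc n) f = begin
    ∏ (m ℕ.+ suc n) f                                    ≡⟨ ≡.cong (λ k → ∏ k f) (ℕₚ.+-suc m n) ⟩
    f (m ℕ.+ n) * ∏ (m ℕ.+ n) f                          ≈⟨ *-congˡ (∏-+ m n f) ⟩
    f (m ℕ.+ n) * (∏ m f * ∏ n (λ i → f (m ℕ.+ i)))
      ≈⟨ solve 3 (λ a b d → a :* (b :* d) := b :* (a :* d)) refl _ _ _ ⟩
    ∏ m f * ∏ (suc n) (λ i → f (m ℕ.+ i))                ∎

  ∏-head : ∀ n f → ∏ (suc n) f ≈ f 0 * ∏ n (λ i → f (suc i))
  ∏-head n f = trans (∏-+ 1 n f) (*-congʳ (*-identityʳ _))

  ∏-reverse : ∀ n f → ∏ n f ≈ ∏ n (λ i → f (n ℕ.∸ suc i))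
  ∏-reverse zero    f = refl
  ∏-reverse (suc n) f = begin
    f n * ∏ n f                              ≈⟨ *-congˡ (∏-reverse n f) ⟩
    f n * ∏ n (λ i → f (n ℕ.∸ suc i))        ≈⟨ ∏-head n (λ i → f (suc n ℕ.∸ suc i)) ⟨
    ∏ (suc n) (λ i → f (suc n ℕ.∸ suc i))    ∎

  ∏-single : ∀ n f r → r < n → (∀ i → i < n → i ≢ r → f i ≈ 1#) → ∏ n f ≈ f r
  ∏-single (suc n) f r r<1+n h with r ℕ.≟ n
  ... | yes ≡.refl = trans (*-congˡ (∏-1 n λ i i<n → h i (ℕₚ.m<n⇒m<1+n i<n) (ℕₚ.<⇒≢ i<n))) (*-identityʳ _)
  ... | no r≢n = trans (*-cong (h n ℕₚ.≤-refl (r≢n ∘ ≡.sym))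
                  (∏-single n f r (ℕₚ.≤∧≢⇒< (ℕₚ.≤-pred r<1+n) r≢n) λ i i<n → h i (ℕₚ.m<n⇒m<1+n i<n)))
                  (*-identityˡ _)

  -- Used with r = 0 to isolate the multiples of a sieving prime, and with q = 6, r = 1 for the
  -- coset of 1 modulo 6.
  ∏-residue : ∀ q r → r < q → ∀ n f →
              (∀ t s → s < q → s ≢ r → f (q ℕ.* t ℕ.+ s) ≈ 1#) →
              ∏ (q ℕ.* n) f ≈ ∏ n (λ t → f (q ℕ.* t ℕ.+ r))
  ∏-residue q r r<q zero    f h = reflexive (≡.cong (λ k → ∏ k f) (ℕₚ.*-zeroʳ q))
  ∏-residue q r r<q (suc n) f h = begin
    ∏ (q ℕ.* suc n) f
      ≡⟨ ≡.cong (λ k → ∏ k f) (≡.trans (ℕₚ.*-suc q n) (ℕₚ.+-comm q _)) ⟩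
    ∏ (q ℕ.* n ℕ.+ q) f                                          ≈⟨ ∏-+ (q ℕ.* n) q f ⟩
    ∏ (q ℕ.* n) f * ∏ q (λ s → f (q ℕ.* n ℕ.+ s))                ≈⟨ *-comm _ _ ⟩
    ∏ q (λ s → f (q ℕ.* n ℕ.+ s)) * ∏ (q ℕ.* n) f
      ≈⟨ *-cong (∏-single q _ r r<q (h n)) (∏-residue q r r<q n f h) ⟩
    f (q ℕ.* n ℕ.+ r) * ∏ n (λ t → f (q ℕ.* t ℕ.+ r))            ∎

  -- A product over a decidable set of indices is a full product with factor 1 elsewhere, branching
  -- on `does` in the manner of `φ-aux`.
  when : ∀ {p} {P : Set p} → Dec P → Carrier → Carrier
  when P? x = if does P? then x else 1#

  module _ {p} {P : Set p} where
    when-yes : (P? : Dec P) → P → ∀ x → when P? x ≈ x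
    when-yes (yes _) _ x = refl
    when-yes (no ¬p) p x = ⊥-elim (¬p p)

    when-no : (P? : Dec P) → ¬ P → ∀ x → when P? x ≈ 1#
    when-no (yes p) ¬p x = ⊥-elim (¬p p)
    when-no (no _)  _  x = refl

    when-* : (P? : Dec P) → ∀ x y → when P? (x * y) ≈ when P? x * when P? y
    when-* (yes _) x y = refl
    when-* (no _)  x y = sym (*-identityˡ _)

  module _ {p q} {P : Set p} {Q : Set q} where
    when-cong : (P? : Dec P) (Q? : Dec Q) → (P → Q) → (Q → P) → ∀ {x y} → (P → x ≈ y) →
                when P? x ≈ when Q? y
    when-cong (yes p) (yes _) f g h = h p
    when-cong (yes p) (no ¬q) f g h = ⊥-elim (¬q (f p))
    when-cong (no ¬p) (yes q) f g h = ⊥-elim (¬p (g q))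
    when-cong (no _)  (no _)  f g h = refl

    when-× : (P? : Dec P) (Q? : Dec Q) → ∀ x → when (P? ×-dec Q?) x ≈ when P? (when Q? x)
    when-× (yes _) (yes _) x = refl
    when-× (yes _) (no _)  x = refl
    when-× (no _)  _       x = refl

    when-⊎ : ∀ {s} {S : Set s} (P? : Dec P) (Q? : Dec Q) (S? : Dec S) →
             (S → P ⊎ Q) → (P → S) → (Q → S) → ¬ (P × Q) →
             ∀ x → when S? x ≈ when P? x * when Q? x
    when-⊎ (yes p) (yes q) S? f g h d x = ⊥-elim (d (p , q))
    when-⊎ (yes p) (no _)  S? f g h d x = trans (when-yes S? (g p) x) (sym (*-identityʳ _))
    when-⊎ (no _)  (yes q) S? f g h d x = trans (when-yes S? (h q) x) (sym (*-identityˡ _))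
    when-⊎ (no ¬p) (no ¬q) S? f g h d x =
      trans (when-no S? (λ s → [ ¬p , ¬q ]′ (f s)) x) (sym (*-identityˡ _))

  ∑-cong : ∀ n {f g} → (∀ i → i < n → f i ≈ g i) → ∑ n f ≈ ∑ n g
  ∑-cong zero    h = refl
  ∑-cong (suc n) h = +-cong (h n ℕₚ.≤-refl) (∑-cong n (λ i i<n → h i (ℕₚ.m<n⇒m<1+n i<n)))

  ∑-1 : ∀ n {f} → (∀ i → i < n → f i ≈ 1#) → ∑ n f ≈ fromℕ R n
  ∑-1 zero    h = refl
  ∑-1 (suc n) h = +-cong (h n ℕₚ.≤-refl) (∑-1 n (λ i i<n → h i (ℕₚ.m<n⇒m<1+n i<n)))

  geometric : ∀ x n → (1# - x) * ∑ n (x ^_) ≈ 1# - x ^ n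
  geometric x zero    = solve 1 (λ x → (con (+ 1) :- x) :* con (+ 0) := con (+ 1) :- con (+ 1)) refl x
  geometric x (suc n) = begin
    (1# - x) * (x ^ n + ∑ n (x ^_))                  ≈⟨ distribˡ _ _ _ ⟩
    (1# - x) * x ^ n + (1# - x) * ∑ n (x ^_)         ≈⟨ +-congˡ (geometric x n) ⟩
    (1# - x) * x ^ n + (1# - x ^ n)
      ≈⟨ solve 2 (λ x y → (con (+ 1) :- x) :* y :+ (con (+ 1) :- y) := con (+ 1) :- x :* y) refl x _ ⟩
    1# - x * x ^ n                                   ∎

  -- Products over roots of unity

  -- coeff k i is the coefficient of xⁱ in ∏_{1 ≤ s ≤ k} (1 - x ηˢ).
  module Coefficients (η : Carrier) where
    coeff : ℕ → ℕ → Carrier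
    coeff k       zero    = 1#
    coeff zero    (suc i) = 0#
    coeff (suc k) (suc i) = coeff k (suc i) - η ^ suc k * coeff k i

    coeff-> : ∀ k i → k < i → coeff k i ≈ 0#
    coeff-> zero    (suc i) _         = refl
    coeff-> (suc k) (suc i) (s≤s k<i) = begin
      coeff k (suc i) - η ^ suc k * coeff k i
        ≈⟨ +-cong (coeff-> k (suc i) (ℕₚ.m<n⇒m<1+n k<i)) (-‿cong (*-congˡ (coeff-> k i k<i))) ⟩
      0# - η ^ suc k * 0#
        ≈⟨ solve 1 (λ y → con (+ 0) :- y :* con (+ 0) := con (+ 0)) refl _ ⟩
      0#                                        ∎

    -- The recursion of `coeff` is multiplication by 1 - xηᵏ⁺¹. Truncating at n allows induction on
    -- n; the sum that gets multiplied by x is one term shorter.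
    partial-sum : ∀ k x n → ∑ (suc n) (λ i → coeff (suc k) i * x ^ i) ≈
                  ∑ (suc n) (λ i → coeff k i * x ^ i) - x * η ^ suc k * ∑ n (λ i → coeff k i * x ^ i)
    partial-sum k x zero    = solve 1 (λ y → con (+ 1) :* con (+ 1) :+ con (+ 0) := (con (+ 1) :* con (+ 1) :+ con (+ 0)) :- y :* con (+ 0)) refl _
    partial-sum k x (suc n) = trans (+-congˡ (partial-sum k x n))
      (solve 7 (λ p y q x xⁿ s t →
          (p :- y :* q) :* (x :* xⁿ) :+ (s :- x :* y :* t) :=
          (p :* (x :* xⁿ) :+ s) :- x :* y :* (q :* xⁿ :+ t))
        refl _ _ _ _ _ _ _)

    expansion : ∀ k x → ∏ k (λ s → 1# - x * η ^ suc s) ≈ ∑ (suc k) (λ i → coeff k i * x ^ i)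
    expansion zero    x = sym (trans (+-identityʳ _) (*-identityˡ _))
    expansion (suc k) x = begin
      (1# - x * η ^ suc k) * ∏ k (λ s → 1# - x * η ^ suc s)  ≈⟨ *-congˡ (expansion k x) ⟩
      (1# - x * η ^ suc k) * ∑ (suc k) f
        ≈⟨ solve 3 (λ y s p → (con (+ 1) :- y) :* s := (con (+ 0) :* p :+ s) :- y :* s) refl _ _ (x ^ suc k) ⟩
      (0# * x ^ suc k + ∑ (suc k) f) - x * η ^ suc k * ∑ (suc k) f
        ≈⟨ +-congʳ (+-congʳ (*-congʳ (coeff-> k (suc k) ℕₚ.≤-refl))) ⟨
      ∑ (suc (suc k)) f - x * η ^ suc k * ∑ (suc k) f        ≈⟨ partial-sum k x (suc k) ⟨
      ∑ (suc (suc k)) (λ i → coeff (suc k) i * x ^ i)        ∎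
      where f = λ i → coeff k i * x ^ i

    -- Comparison of coefficients in (1 - x ηᵏ⁺¹) Eₖ(x) = (1 - x η) Eₖ(x η), where Eₖ = ∏_{1 ≤ s ≤ k} (1 - x ηˢ).
    coeff-recurrence : ∀ k i → (1# - η ^ suc i) * coeff k (suc i) ≈ (η ^ suc k - η ^ suc i) * coeff k i
    coeff-recurrence zero    zero    = solve 1 (λ a → (con (+ 1) :- a) :* con (+ 0) := (a :- a) :* con (+ 1)) refl _
    coeff-recurrence zero    (suc i) = solve 2 (λ a b → (con (+ 1) :- a) :* con (+ 0) := (b :- a) :* con (+ 0)) refl _ _
    coeff-recurrence (suc k) zero    = begin
      (1# - z) * (p - y * 1#)
        ≈⟨ solve 3 (λ z p y → (con (+ 1) :- z) :* (p :- y :* con (+ 1)) := (con (+ 1) :- z) :* p :- (con (+ 1) :- z) :* y) refl z p y ⟩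
      (1# - z) * p - (1# - z) * y     ≈⟨ +-congʳ (coeff-recurrence k zero) ⟩
      (y - z) * 1# - (1# - z) * y
        ≈⟨ solve 2 (λ a y → (y :- a :* con (+ 1)) :* con (+ 1) :- (con (+ 1) :- a :* con (+ 1)) :* y := (a :* y :- a :* con (+ 1)) :* con (+ 1)) refl η y ⟩
      (η * y - z) * 1#                ∎
      where
      y = η ^ suc k
      z = η ^ 1
      p = coeff k 1
    coeff-recurrence (suc k) (suc i) = begin
      (1# - z) * (p - y * q)
        ≈⟨ solve 4 (λ z p y q → (con (+ 1) :- z) :* (p :- y :* q) := (con (+ 1) :- z) :* p :- (con (+ 1) :- z) :* y :* q) refl z p y q ⟩
      (1# - z) * p - (1# - z) * y * q                   ≈⟨ +-congʳ (coeff-recurrence k (suc i)) ⟩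
      (y - z) * q - (1# - z) * y * q
        ≈⟨ solve 4 (λ a w y q → (y :- a :* w) :* q :- (con (+ 1) :- a :* w) :* y :* q := (a :* y :- a :* w) :* q :- a :* y :* ((con (+ 1) :- w) :* q)) refl η w y q ⟩
      (η * y - z) * q - η * y * ((1# - w) * q)          ≈⟨ +-congˡ (-‿cong (*-congˡ (coeff-recurrence k i))) ⟩
      (η * y - z) * q - η * y * ((y - w) * r)
        ≈⟨ solve 5 (λ a w y q r → (a :* y :- a :* w) :* q :- a :* y :* ((y :- w) :* r) := (a :* y :- a :* w) :* (q :- y :* r)) refl η w y q r ⟩
      (η * y - z) * (q - y * r)                         ∎
      where
      y = η ^ suc k
      w = η ^ suc i
      z = η ^ suc (suc i)
      p = coeff k (suc (suc i))
      q = coeff k (suc i)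
      r = coeff k i

  module Domain (domain : IsIntegralDomain R) where

    *-cancelˡ : ∀ {a} → ¬ a ≈ 0# → ∀ {b d} → a * b ≈ a * d → b ≈ d
    *-cancelˡ {a} a≉0 {b} {d} ab≈ad
      with proj₂ domain a (b - d) (trans (solve 3 (λ a b d → a :* (b :- d) := a :* b :- a :* d) refl a b d)
                                         (trans (+-congʳ ab≈ad) (-‿inverseʳ _)))
    ... | inj₁ a≈0   = ⊥-elim (a≉0 a≈0)
    ... | inj₂ b-d≈0 = trans (solve 2 (λ b d → b := (b :- d) :+ d) refl b d)
                             (trans (+-congʳ b-d≈0) (+-identityˡ _))

    module _ (η : Carrier) (d : ℕ) (η-primitive : IsPrimitiveRoot R (suc d) η) where
      open Coefficients η

      -- At k = d the power ηᵏ⁺¹ is 1, so `coeff-recurrence` has the same factor 1 - ηⁱ⁺¹ on both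
      -- sides. It is nonzero for i < d by primitivity, and all coefficients agree with the constant
      -- one.
      coeff≈1 : ∀ i → i ≤ d → coeff d i ≈ 1#
      coeff≈1 zero    _   = refl
      coeff≈1 (suc i) i<d = trans (*-cancelˡ 1-ηⁱ≉0 (trans (coeff-recurrence d i) (*-congʳ (+-congʳ (proj₁ η-primitive)))))
                                  (coeff≈1 i (ℕₚ.<⇒≤ i<d))
        where
        1-ηⁱ≉0 : ¬ 1# - η ^ suc i ≈ 0#
        1-ηⁱ≉0 eq = proj₂ η-primitive (suc i) (s≤s z≤n) (s≤s i<d)
          (trans (solve 1 (λ y → y := con (+ 1) :- (con (+ 1) :- y)) refl _)
                 (trans (+-congˡ (-‿cong eq)) (trans (+-congˡ -0#≈0#) (+-identityʳ _))))

      -- Unlike `∏-roots` this keeps its content at x = 1, where the sum is d + 1; cancelling 1 - x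
      -- could not give it there.
      ∏-nontrivial-roots : ∀ x → ∏ d (λ s → 1# - x * η ^ suc s) ≈ ∑ (suc d) (x ^_)
      ∏-nontrivial-roots x = trans (expansion d x)
        (∑-cong (suc d) λ i i<1+d → trans (*-congʳ (coeff≈1 i (ℕₚ.≤-pred i<1+d))) (*-identityˡ _))

      ∏-roots : ∀ x → ∏ (suc d) (λ t → 1# - x * η ^ t) ≈ 1# - x ^ suc d
      ∏-roots x = begin
        ∏ (suc d) (λ t → 1# - x * η ^ t)                          ≈⟨ ∏-head d _ ⟩
        (1# - x * 1#) * ∏ d (λ t → 1# - x * η ^ suc t)
          ≈⟨ *-cong (+-congˡ (-‿cong (*-identityʳ x))) (∏-nontrivial-roots x) ⟩
        (1# - x) * ∑ (suc d) (x ^_)                               ≈⟨ geometric x (suc d) ⟩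
        1# - x ^ suc d                                            ∎

    -- Rotating the indices by r turns the remaining roots into the nontrivial ones, with xηʳ in
    -- place of x. The indices above r come first; those below r wrap around by ηᴺ = 1.
    ∏-other-roots : ∀ η N → IsPrimitiveRoot R N η → ∀ r → r < N → ∀ x →
                    ∏ N (λ t → when (¬? (t ℕ.≟ r)) (1# - x * η ^ t)) ≈ ∑ N ((x * η ^ r) ^_)
    ∏-other-roots η N η-primitive r r<N x with ℕₚ.m≤n⇒∃[o]m+o≡n r<N
    ... | d , ≡.refl = begin
      ∏ (suc (r ℕ.+ d)) f                                         ≡⟨ ≡.cong (λ k → ∏ k f) (ℕₚ.+-suc r d) ⟨
      ∏ (r ℕ.+ suc d) f                                           ≈⟨ ∏-+ r (suc d) f ⟩
      ∏ r f * ∏ (suc d) (λ s → f (r ℕ.+ s))                       ≈⟨ *-congˡ (∏-head d (λ s → f (r ℕ.+ s))) ⟩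
      ∏ r f * (f (r ℕ.+ 0) * ∏ d (λ s → f (r ℕ.+ suc s)))
        ≈⟨ *-cong (∏-cong r before) (*-cong (when-no (¬? (r ℕ.+ 0 ℕ.≟ r)) (λ k → k (ℕₚ.+-identityʳ r)) _) (∏-cong d after)) ⟩
      ∏ r (λ t → g (d ℕ.+ t)) * (1# * ∏ d g)
        ≈⟨ solve 2 (λ a b → a :* (con (+ 1) :* b) := b :* a) refl _ _ ⟩
      ∏ d g * ∏ r (λ t → g (d ℕ.+ t))                             ≈⟨ ∏-+ d r g ⟨
      ∏ (d ℕ.+ r) g                                               ≡⟨ ≡.cong (λ k → ∏ k g) (ℕₚ.+-comm d r) ⟩
      ∏ (r ℕ.+ d) g
        ≈⟨ ∏-nontrivial-roots η (r ℕ.+ d) η-primitive (x * η ^ r) ⟩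
      ∑ (suc (r ℕ.+ d)) ((x * η ^ r) ^_)                          ∎
      where
      f g : ℕ → Carrier
      f t = when (¬? (t ℕ.≟ r)) (1# - x * η ^ t)
      g s = 1# - x * η ^ r * η ^ suc s
      before : ∀ t → t < r → f t ≈ g (d ℕ.+ t)
      before t t<r = trans (when-yes (¬? (t ℕ.≟ r)) (ℕₚ.<⇒≢ t<r) _) (+-congˡ (-‿cong (begin
        x * η ^ t                              ≈⟨ *-congˡ (^-period (suc (r ℕ.+ d)) (proj₁ η-primitive) t 1) ⟨
        x * η ^ (t ℕ.+ 1 ℕ.* suc (r ℕ.+ d))    ≡⟨ ≡.cong (λ k → x * η ^ k) (arith r d t) ⟩
        x * η ^ (r ℕ.+ suc (d ℕ.+ t))          ≈⟨ *-congˡ (^-+ η r (suc (d ℕ.+ t))) ⟩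
        x * (η ^ r * η ^ suc (d ℕ.+ t))        ≈⟨ *-assoc _ _ _ ⟨
        x * η ^ r * η ^ suc (d ℕ.+ t)          ∎)))
        where
        arith : ∀ r d t → t ℕ.+ 1 ℕ.* suc (r ℕ.+ d) ≡ r ℕ.+ suc (d ℕ.+ t)
        arith = solve-∀
      after : ∀ s → s < d → f (r ℕ.+ suc s) ≈ g s
      after s _ = trans (when-yes (¬? (r ℕ.+ suc s ℕ.≟ r)) (ℕₚ.m+1+n≢m r) _)
                        (+-congˡ (-‿cong (trans (*-congˡ (^-+ η r (suc s))) (sym (*-assoc _ _ _)))))

  -- Sieved products in R

  sieved : ℕ → (ℕ → Carrier) → List ℕ → Carrier
  sieved n g qs = ∏ (3 ℕ.* n) (λ i → when (survives? n qs i) (g i))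

  sieved-cong : ∀ n {g h} qs → (∀ i → g i ≈ h i) → sieved n g qs ≈ sieved n h qs
  sieved-cong n qs g≈h = ∏-cong (3 ℕ.* n) λ i _ →
    when-cong (survives? n qs i) (survives? n qs i) (λ s → s) (λ s → s) (λ _ → g≈h i)

  -- The survivors for `qs` split into those prime to q and the multiples q * t. The latter are a
  -- scaled copy of the sieve at level n, since every other condition on q * t is the same condition
  -- on t.
  sieved-∷ : ∀ q n g qs → Prime q → Unit6 q → All Prime qs → All (q ≢_) qs →
             sieved (q ℕ.* n) g (q ∷ qs) * sieved n (λ i → g (q ℕ.* i)) qs ≈ sieved (q ℕ.* n) g qs
  sieved-∷ q n g qs pq uq pqs q∉qs = sym (begin
    ∏ (3 ℕ.* N) (λ i → when (S? i) (g i))                        ≈⟨ ∏-cong (3 ℕ.* N) split ⟩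
    ∏ (3 ℕ.* N) (λ i → when (S′? i) (g i) * F i)                 ≈⟨ ∏-* (3 ℕ.* N) _ _ ⟩
    sieved N g (q ∷ qs) * ∏ (3 ℕ.* N) F
      ≡⟨ ≡.cong (λ k → sieved N g (q ∷ qs) * ∏ k F) (arith q n) ⟩
    sieved N g (q ∷ qs) * ∏ (q ℕ.* (3 ℕ.* n)) F
      ≈⟨ *-congˡ (∏-residue q 0 (unit6⇒≥1 uq) (3 ℕ.* n) F nonmultiple) ⟩
    sieved N g (q ∷ qs) * ∏ (3 ℕ.* n) (λ t → F (q ℕ.* t ℕ.+ 0))  ≈⟨ *-congˡ (∏-cong (3 ℕ.* n) λ t _ → multiple t) ⟩
    sieved N g (q ∷ qs) * sieved n (λ i → g (q ℕ.* i)) qs        ∎)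
    where
    N = q ℕ.* n
    S? = survives? N qs
    S′? = survives? N (q ∷ qs)
    F : ℕ → Carrier
    F i = when ((q ∣? i) ×-dec S? i) (g i)
    arith : ∀ q n → 3 ℕ.* (q ℕ.* n) ≡ q ℕ.* (3 ℕ.* n)
    arith = solve-∀
    split : ∀ i → i < 3 ℕ.* N → when (S? i) (g i) ≈ when (S′? i) (g i) * F i
    split i _ = when-⊎ (S′? i) ((q ∣? i) ×-dec S? i) (S? i) cases
      (λ { (u , n∤ , _ ∷ qs∤) → u , n∤ , qs∤ }) proj₂
      (λ { ((_ , _ , q∤ ∷ _) , q∣ , _) → q∤ q∣ }) (g i)
      where
      cases : Survives N qs i → Survives N (q ∷ qs) i ⊎ (q ∣ i × Survives N qs i)
      cases s@(u , n∤ , qs∤) with q ∣? i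
      ... | yes q∣i = inj₂ (q∣i , s)
      ... | no q∤i  = inj₁ (u , n∤ , q∤i ∷ qs∤)
    nonmultiple : ∀ t s → s < q → s ≢ 0 → F (q ℕ.* t ℕ.+ s) ≈ 1#
    nonmultiple t s s<q s≢0 = when-no ((q ∣? (q ℕ.* t ℕ.+ s)) ×-dec S? (q ℕ.* t ℕ.+ s))
      (λ { (q∣ , _) → ℕₚ.<⇒≱ s<q (∣⇒≤ {{ℕ.≢-nonZero s≢0}} (∣m+n∣m⇒∣n q∣ (m∣m*n t))) }) _
    multiple : ∀ t → F (q ℕ.* t ℕ.+ 0) ≈ when (survives? n qs t) (g (q ℕ.* t))
    multiple t = trans (reflexive (≡.cong F (ℕₚ.+-identityʳ (q ℕ.* t))))
      (when-cong ((q ∣? (q ℕ.* t)) ×-dec S? (q ℕ.* t)) (survives? n qs t)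
        (λ { (_ , s) → survives-*⁻ q n qs t s })
        (λ s → m∣m*n t , survives-*⁺ q n qs t pq uq pqs q∉qs s)
        (λ _ → refl))

  -- Up to i ↦ 6k - i, the residues prime to 6 below 3k are those congruent to 1 below 6k.
  ∏-unit6 : ∀ k (h : ℕ → Carrier) → (∀ i → i ≤ 6 ℕ.* k → h (6 ℕ.* k ℕ.∸ i) ≈ h i) →
            ∏ (3 ℕ.* k) (λ i → when (unit6? i) (h i)) ≈ ∏ k (λ t → h (6 ℕ.* t ℕ.+ 1))
  ∏-unit6 k h h-sym = begin
    ∏ 3k (λ i → when (unit6? i) (h i))
      ≈⟨ ∏-cong 3k (λ i _ → when-⊎ (is1? i) (is5? i) (unit6? i) (λ u → u) inj₁ inj₂ (λ { (e , f) → 1≢5 (≡.trans (≡.sym e) f) }) (h i)) ⟩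
    ∏ 3k (λ i → F₁ i * F₅ i)                       ≈⟨ ∏-* 3k F₁ F₅ ⟩
    ∏ 3k F₁ * ∏ 3k F₅                              ≈⟨ *-congˡ shift ⟨
    ∏ 3k F₁ * ∏ 3k (λ i → F₅ (suc i))              ≈⟨ *-congˡ (trans (∏-reverse 3k _) (∏-cong 3k reflect)) ⟨
    ∏ 3k F₁ * ∏ 3k (λ i → F₁ (3k ℕ.+ i))           ≈⟨ ∏-+ 3k 3k F₁ ⟨
    ∏ (3k ℕ.+ 3k) F₁                               ≡⟨ ≡.cong (λ m → ∏ m F₁) (6k≡ k) ⟨
    ∏ (6 ℕ.* k) F₁
      ≈⟨ ∏-residue 6 1 (s≤s (s≤s z≤n)) k F₁ (λ t s s<6 s≢1 → when-no (is1? (6 ℕ.* t ℕ.+ s)) (λ e → s≢1 (≡.trans (≡.sym (residue t s<6)) e)) _) ⟩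
    ∏ k (λ t → F₁ (6 ℕ.* t ℕ.+ 1))
      ≈⟨ ∏-cong k (λ t _ → when-yes (is1? (6 ℕ.* t ℕ.+ 1)) (residue t (s≤s (s≤s z≤n))) _) ⟩
    ∏ k (λ t → h (6 ℕ.* t ℕ.+ 1))                  ∎
    where
    3k = 3 ℕ.* k
    is1? : Decidable (λ i → i ℕ.% 6 ≡ 1)
    is1? i = (i ℕ.% 6) ℕ.≟ 1
    is5? : Decidable (λ i → i ℕ.% 6 ≡ 5)
    is5? i = (i ℕ.% 6) ℕ.≟ 5
    F₁ F₅ : ℕ → Carrier
    F₁ i = when (is1? i) (h i)
    F₅ i = when (is5? i) (h i)
    1≢5 : 1 ≢ 5
    1≢5 ()
    6k≡ : ∀ k → 6 ℕ.* k ≡ 3 ℕ.* k ℕ.+ 3 ℕ.* k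
    6k≡ = solve-∀
    residue : ∀ t {s} → s < 6 → (6 ℕ.* t ℕ.+ s) ℕ.% 6 ≡ s
    residue t {s} s<6 = ≡.trans (≡.cong (ℕ._% 6) (≡.trans (ℕₚ.+-comm (6 ℕ.* t) s) (≡.cong (s ℕ.+_) (ℕₚ.*-comm 6 t))))
                                (≡.trans ([m+kn]%n≡m%n s t 6) (m<n⇒m%n≡m s<6))
    -- Reflection sends the upper half to the indices 1 to 3k instead of 0 to 3k - 1. This does no
    -- harm, as neither 0 nor 3k is 5 modulo 6.
    shift : ∏ 3k (λ i → F₅ (suc i)) ≈ ∏ 3k F₅
    shift = begin
      ∏ 3k (λ i → F₅ (suc i))           ≈⟨ *-identityˡ _ ⟨
      F₅ 0 * ∏ 3k (λ i → F₅ (suc i))    ≈⟨ ∏-head 3k F₅ ⟨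
      F₅ 3k * ∏ 3k F₅
        ≈⟨ *-congʳ (when-no (is5? 3k) (λ e → from-yes (¬? (3 ∣? 5)) (≡.subst (3 ∣_) e (∣-mod6⁺ 3∣6 (m∣m*n k)))) _) ⟩
      1# * ∏ 3k F₅                      ≈⟨ *-identityˡ _ ⟩
      ∏ 3k F₅                           ∎
    reflect : ∀ i → i < 3k → F₁ (3k ℕ.+ (3k ℕ.∸ suc i)) ≈ F₅ (suc i)
    reflect i i<3k = begin
      F₁ (3k ℕ.+ (3k ℕ.∸ suc i))
        ≡⟨ ≡.cong F₁ (≡.trans (≡.sym (ℕₚ.+-∸-assoc 3k i<3k)) (≡.cong (ℕ._∸ suc i) (≡.sym (6k≡ k)))) ⟩
      F₁ j                          ≈⟨ when-cong (is1? j) (is5? (suc i))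
                                         (λ e → mod6-finite (λ r s → (r ℕ.+ s) ℕ.% 6 ≡ 0 → r ≡ 1 → s ≡ 5)
                                           (λ r s → ((r ℕ.+ s) ℕ.% 6 ℕ.≟ 0) →-dec (r ℕ.≟ 1) →-dec (s ℕ.≟ 5)) j (suc i) sum≡0 e)
                                         (λ e → mod6-finite (λ r s → (r ℕ.+ s) ℕ.% 6 ≡ 0 → s ≡ 5 → r ≡ 1)
                                           (λ r s → ((r ℕ.+ s) ℕ.% 6 ℕ.≟ 0) →-dec (s ℕ.≟ 5) →-dec (r ℕ.≟ 1)) j (suc i) sum≡0 e)
                                         (λ _ → h-sym (suc i) i<6k) ⟩
      F₅ (suc i)                    ∎
      where
      j = 6 ℕ.* k ℕ.∸ suc i
      i<6k : suc i ≤ 6 ℕ.* k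
      i<6k = ℕₚ.≤-trans i<3k (≡.subst (3k ≤_) (≡.sym (6k≡ k)) (ℕₚ.m≤m+n 3k 3k))
      sum≡0 : ((j ℕ.% 6) ℕ.+ (suc i ℕ.% 6)) ℕ.% 6 ≡ 0
      sum≡0 = ≡.trans (≡.sym (%-distribˡ-+ j (suc i) 6)) (≡.trans (≡.cong (ℕ._% 6) (ℕₚ.m∸n+n≡m i<6k))
                (≡.trans (≡.cong (ℕ._% 6) (ℕₚ.*-comm 6 k)) ([m+kn]%n≡m%n 0 k 6)))

  -- Inverses and sixth roots of unity

  inverse-power : ∀ {x y} N → x * y ≈ 1# → x ^ N ≈ 1# → ∀ i → i ≤ N → x ^ (N ℕ.∸ i) ≈ y ^ i
  inverse-power {x} {y} N xy≈1 xᴺ≈1 i i≤N = begin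
    x ^ (N ℕ.∸ i)                      ≈⟨ *-identityʳ _ ⟨
    x ^ (N ℕ.∸ i) * 1#                 ≈⟨ *-congˡ (trans (^-congˡ i xy≈1) (1^ i)) ⟨
    x ^ (N ℕ.∸ i) * (x * y) ^ i        ≈⟨ *-congˡ (*-^ x y i) ⟩
    x ^ (N ℕ.∸ i) * (x ^ i * y ^ i)    ≈⟨ *-assoc _ _ _ ⟨
    x ^ (N ℕ.∸ i) * x ^ i * y ^ i      ≈⟨ *-congʳ (^-+ x (N ℕ.∸ i) i) ⟨
    x ^ (N ℕ.∸ i ℕ.+ i) * y ^ i        ≡⟨ ≡.cong (λ k → x ^ k * y ^ i) (ℕₚ.m∸n+n≡m i≤N) ⟩
    x ^ N * y ^ i                      ≈⟨ *-congʳ xᴺ≈1 ⟩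
    1# * y ^ i                         ≈⟨ *-identityˡ _ ⟩
    y ^ i                              ∎

  primitive-^ : ∀ {ζ} q m → 1 ≤ q → IsPrimitiveRoot R (q ℕ.* m) ζ → IsPrimitiveRoot R m (ζ ^ q)
  primitive-^ {ζ} q@(suc _) m 1≤q (ζᵐ≈1 , minimal) = trans (sym (^-* ζ q m)) ζᵐ≈1 ,
    λ d 1≤d d<m eq → minimal (q ℕ.* d) (ℕₚ.*-mono-≤ 1≤q 1≤d) (ℕₚ.*-monoʳ-< q d<m) (trans (^-* ζ q d) eq)

  primitive-inverse : ∀ {x y} m → x * y ≈ 1# → IsPrimitiveRoot R m x → IsPrimitiveRoot R m y
  primitive-inverse {x} {y} m xy≈1 (xᵐ≈1 , minimal) = to m xᵐ≈1 , λ d 1≤d d<m yᵈ≈1 → minimal d 1≤d d<m (from d yᵈ≈1)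
    where
    both : ∀ d → x ^ d * y ^ d ≈ 1#
    both d = trans (sym (*-^ x y d)) (trans (^-congˡ d xy≈1) (1^ d))
    to : ∀ d → x ^ d ≈ 1# → y ^ d ≈ 1#
    to d e = trans (sym (*-identityˡ _)) (trans (*-congʳ (sym e)) (both d))
    from : ∀ d → y ^ d ≈ 1# → x ^ d ≈ 1#
    from d e = trans (sym (*-identityʳ _)) (trans (*-congˡ (sym e)) (both d))

  -- The extra factor a avoids the exponent n - 1: the power aⁿ can be reduced modulo 6 at once, and
  -- `divide-α` removes the factor afterwards.
  ∏-const-except : ∀ n r → r < n → ∀ a → ∏ n (λ t → when (¬? (t ℕ.≟ r)) a) * a ≈ a ^ n
  ∏-const-except n r r<n a = begin
    ∏ n F * a                                       ≈⟨ *-congˡ (when-yes (r ℕ.≟ r) ≡.refl a) ⟨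
    ∏ n F * G r
      ≈⟨ *-congˡ (∏-single n G r r<n (λ i _ i≢r → when-no (i ℕ.≟ r) i≢r a)) ⟨
    ∏ n F * ∏ n G                                   ≈⟨ ∏-* n F G ⟨
    ∏ n (λ t → F t * G t)                           ≈⟨ ∏-cong n (λ t _ → complementary (t ℕ.≟ r)) ⟩
    ∏ n (λ _ → a)                                   ≈⟨ ∏-const n a ⟩
    a ^ n                                           ∎
    where
    F G : ℕ → Carrier
    F t = when (¬? (t ℕ.≟ r)) a
    G t = when (t ℕ.≟ r) a
    complementary : ∀ {P : Set} (P? : Dec P) → when (¬? P?) a * when P? a ≈ a
    complementary (yes _) = *-identityˡ a
    complementary (no _)  = *-identityʳ a

  -- The inverse is a separate argument, so that negative powers need no truncated subtraction.
  1-x-x⁻¹ : Carrier → Carrier → ℕ → Carrier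
  1-x-x⁻¹ ζ ζ′ i = 1# - ζ ^ i - ζ′ ^ i

  module SixthRoot (β : Carrier) (β²≈β-1 : β * β ≈ β - 1#) where
    β²-β+1≈0 : β * β - β + 1# ≈ 0#
    β²-β+1≈0 = trans (+-congʳ (+-congʳ β²≈β-1)) (solve 1 (λ b → ((b :- con (+ 1)) :- b) :+ con (+ 1) := con (+ 0)) refl β)

    -- Equality modulo the sixth cyclotomic polynomial in β, with m as the explicit cofactor; the
    -- solver then checks a polynomial identity.
    reduce : ∀ {x y} m → x ≈ y + m * (β * β - β + 1#) → x ≈ y
    reduce m eq = trans eq (trans (+-congˡ (trans (*-congˡ β²-β+1≈0) (zeroʳ m))) (+-identityʳ _))

    β²≈ : β ^ 2 ≈ β - 1#
    β²≈ = trans (*-congˡ (*-identityʳ β)) β²≈β-1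

    β³≈ : β ^ 3 ≈ - 1#
    β³≈ = reduce (β + 1#) (solve 1 (λ b → b :* (b :* (b :* con (+ 1))) := (:- con (+ 1)) :+ (b :+ con (+ 1)) :* (b :* b :- b :+ con (+ 1))) refl β)

    β⁴≈ : β ^ 4 ≈ - β
    β⁴≈ = trans (*-congˡ β³≈) (solve 1 (λ b → b :* (:- con (+ 1)) := :- b) refl β)

    β⁵≈ : β ^ 5 ≈ 1# - β
    β⁵≈ = reduce (- 1#) (trans (*-congˡ β⁴≈) (solve 1 (λ b → b :* (:- b) := (con (+ 1) :- b) :+ (:- con (+ 1)) :* (b :* b :- b :+ con (+ 1))) refl β))

    β⁶≈ : β ^ 6 ≈ 1#
    β⁶≈ = trans (^-* β 3 2) (trans (^-congˡ 2 β³≈) (solve 0 ((:- con (+ 1)) :* ((:- con (+ 1)) :* con (+ 1)) := con (+ 1)) refl))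

    ^-mod6 : ∀ k → β ^ k ≈ β ^ (k ℕ.% 6)
    ^-mod6 k = trans (reflexive (≡.cong (β ^_) (m≡m%n+[m/n]*n k 6))) (^-period 6 β⁶≈ (k ℕ.% 6) (k ℕ./ 6))

    ω : Carrier
    ω = β * β

    ω²+ω+1≈0 : ω * ω + ω + 1# ≈ 0#
    ω²+ω+1≈0 = reduce (β * β + β + 1#) (solve 1 (λ b → (b :* b) :* (b :* b) :+ b :* b :+ con (+ 1) :=
      con (+ 0) :+ (b :* b :+ b :+ con (+ 1)) :* (b :* b :- b :+ con (+ 1))) refl β)

    -- ω is a cube root of unity with 1 + ω + ω² = 0, so six consecutive powers form two vanishing
    -- blocks. The period 6 rather than 3 fits the residue of k.
    ∑-ω-+6 : ∀ m → ∑ (6 ℕ.+ m) (ω ^_) ≈ ∑ m (ω ^_)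
    ∑-ω-+6 m = begin
      ∑ (6 ℕ.+ m) (ω ^_)                                                    ≈⟨ solve 3 (λ w x s →
          w :* (w :* (w :* (w :* (w :* x)))) :+ (w :* (w :* (w :* (w :* x))) :+ (w :* (w :* (w :* x)) :+
            (w :* (w :* x) :+ (w :* x :+ (x :+ s))))) :=
          (w :* w :* w :+ con (+ 1)) :* x :* (w :* w :+ w :+ con (+ 1)) :+ s) refl ω (ω ^ m) (∑ m (ω ^_)) ⟩
      (ω * ω * ω + 1#) * ω ^ m * (ω * ω + ω + 1#) + ∑ m (ω ^_)
        ≈⟨ +-congʳ (trans (*-congˡ ω²+ω+1≈0) (zeroʳ _)) ⟩
      0# + ∑ m (ω ^_)                                                       ≈⟨ +-identityˡ _ ⟩
      ∑ m (ω ^_)                                                            ∎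

    ∑-ω-*6 : ∀ s r → ∑ (s ℕ.* 6 ℕ.+ r) (ω ^_) ≈ ∑ r (ω ^_)
    ∑-ω-*6 zero    r = refl
    ∑-ω-*6 (suc s) r = trans (∑-ω-+6 (s ℕ.* 6 ℕ.+ r)) (∑-ω-*6 s r)

    ∑-ω-mod6 : ∀ k → ∑ k (ω ^_) ≈ ∑ (k ℕ.% 6) (ω ^_)
    ∑-ω-mod6 k = trans
      (reflexive (≡.cong (λ m → ∑ m (ω ^_)) (≡.trans (m≡m%n+[m/n]*n k 6) (ℕₚ.+-comm (k ℕ.% 6) _))))
      (∑-ω-*6 (k ℕ./ 6) (k ℕ.% 6))

    ∑-ω-5 : ∑ 5 (ω ^_) ≈ β
    ∑-ω-5 = begin
      ∑ 5 (ω ^_)                                    ≈⟨ solve 1 (λ w →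
          w :* (w :* (w :* (w :* con (+ 1)))) :+ (w :* (w :* (w :* con (+ 1))) :+ (w :* (w :* con (+ 1)) :+
            (w :* con (+ 1) :+ (con (+ 1) :+ con (+ 0))))) :=
          w :+ con (+ 1) :+ w :* w :* (w :* w :+ w :+ con (+ 1))) refl ω ⟩
      ω + 1# + ω * ω * (ω * ω + ω + 1#)             ≈⟨ +-congˡ (trans (*-congˡ ω²+ω+1≈0) (zeroʳ _)) ⟩
      ω + 1# + 0#                                   ≈⟨ +-congʳ (+-congʳ β²≈β-1) ⟩
      β - 1# + 1# + 0#
        ≈⟨ solve 1 (λ b → b :- con (+ 1) :+ con (+ 1) :+ con (+ 0) := b) refl β ⟩
      β                                             ∎

  -- Evaluation of the base products

  module BaseProduct (domain : IsIntegralDomain R) (k : ℕ) (1≤k : 1 ≤ k) {ζ ζ′ : Carrier} (ζζ′≈1 : ζ * ζ′ ≈ 1#)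
                     (ζ-primitive : IsPrimitiveRoot R (6 ℕ.* k) ζ) where
    open Domain domain

    instance
      k≢0 : ℕ.NonZero k
      k≢0 = ℕ.>-nonZero 1≤k

    α α′ η η′ : Carrier
    α  = ζ ^ k
    α′ = ζ′ ^ k
    η  = ζ ^ 6
    η′ = ζ′ ^ 6

    αα′≈1 : α * α′ ≈ 1#
    αα′≈1 = trans (sym (*-^ ζ ζ′ k)) (trans (^-congˡ k ζζ′≈1) (1^ k))

    α^≉1 : ∀ j → 1 ≤ j → j < 6 → ¬ α ^ j ≈ 1#
    α^≉1 j 1≤j j<6 eq = proj₂ ζ-primitive (k ℕ.* j) (ℕₚ.*-mono-≤ 1≤k 1≤j)
      (≡.subst (k ℕ.* j <_) (ℕₚ.*-comm k 6) (ℕₚ.*-monoʳ-< k j<6)) (trans (^-* ζ k j) eq)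

    -- In a domain one factor of x⁶ - 1 = (x³ - 1)(x + 1)(x² - x + 1) vanishes at α; the first two
    -- would give α³ = 1 or α² = 1.
    α²-α+1≈0 : α * α - α + 1# ≈ 0#
    α²-α+1≈0 with proj₂ domain (α * α * α - 1#) (α * α * α + 1#) (trans
                    (solve 1 (λ a → (a :* a :* a :- con (+ 1)) :* (a :* a :* a :+ con (+ 1)) :=
                       a :* (a :* (a :* (a :* (a :* (a :* con (+ 1)))))) :- con (+ 1)) refl α)
                    (trans (+-congʳ α⁶≈1) (-‿inverseʳ 1#)))
      where
      α⁶≈1 : α ^ 6 ≈ 1#
      α⁶≈1 = trans (sym (^-* ζ k 6)) (trans (reflexive (≡.cong (ζ ^_) (ℕₚ.*-comm k 6))) (proj₁ ζ-primitive))
    ... | inj₁ e = ⊥-elim (α^≉1 3 (s≤s z≤n) (s≤s (s≤s (s≤s (s≤s z≤n))))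
          (trans (solve 1 (λ a → a :* (a :* (a :* con (+ 1))) := (a :* a :* a :- con (+ 1)) :+ con (+ 1)) refl α)
                 (trans (+-congʳ e) (+-identityˡ 1#))))
    ... | inj₂ e with proj₂ domain (α + 1#) (α * α - α + 1#) (trans
                        (solve 1 (λ a → (a :+ con (+ 1)) :* (a :* a :- a :+ con (+ 1)) := a :* a :* a :+ con (+ 1)) refl α) e)
    ...   | inj₂ f = f
    ...   | inj₁ f = ⊥-elim (α^≉1 2 (s≤s z≤n) (s≤s (s≤s (s≤s z≤n)))
            (trans (solve 1 (λ a → a :* (a :* con (+ 1)) := (a :- con (+ 1)) :* (a :+ con (+ 1)) :+ con (+ 1)) refl α)
                   (trans (+-congʳ (trans (*-congˡ f) (zeroʳ _))) (+-identityˡ 1#))))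

    -- Obtained by multiplying α² - α + 1 = 0 by α′. It says u k = 0: the factor left out is indeed
    -- zero.
    α+α′≈1 : α + α′ ≈ 1#
    α+α′≈1 = begin
      α + α′
        ≈⟨ solve 2 (λ a b → a :+ b := a :* con (+ 1) :- con (+ 1) :+ b :+ con (+ 1)) refl α α′ ⟩
      α * 1# - 1# + α′ + 1#                         ≈⟨ +-congʳ (+-congʳ (+-cong (*-congˡ αα′≈1) (-‿cong αα′≈1))) ⟨
      α * (α * α′) - α * α′ + α′ + 1#
        ≈⟨ solve 2 (λ a b → a :* (a :* b) :- a :* b :+ b :+ con (+ 1) := b :* (a :* a :- a :+ con (+ 1)) :+ con (+ 1)) refl α α′ ⟩
      α′ * (α * α - α + 1#) + 1#                    ≈⟨ +-congʳ (trans (*-congˡ α²-α+1≈0) (zeroʳ _)) ⟩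
      0# + 1#                                       ≈⟨ +-identityˡ 1# ⟩
      1#                                            ∎

    α²≈α-1 : α * α ≈ α - 1#
    α²≈α-1 = trans (solve 1 (λ a → a :* a := (a :* a :- a :+ con (+ 1)) :+ (a :- con (+ 1))) refl α)
                   (trans (+-congʳ α²-α+1≈0) (+-identityˡ _))

    α′≈1-α : α′ ≈ 1# - α
    α′≈1-α = trans (solve 2 (λ a b → b := (a :+ b) :- a) refl α α′) (+-congʳ α+α′≈1)

    α′²≈α′-1 : α′ * α′ ≈ α′ - 1#
    α′²≈α′-1 = begin
      α′ * α′                   ≈⟨ *-cong α′≈1-α α′≈1-α ⟩
      (1# - α) * (1# - α)
        ≈⟨ solve 1 (λ a → (con (+ 1) :- a) :* (con (+ 1) :- a) := a :* a :+ con (+ 1) :- a :- a) refl α ⟩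
      α * α + 1# - α - α        ≈⟨ +-congʳ (+-congʳ (+-congʳ α²≈α-1)) ⟩
      α - 1# + 1# - α - α
        ≈⟨ solve 1 (λ a → a :- con (+ 1) :+ con (+ 1) :- a :- a := (con (+ 1) :- a) :- con (+ 1)) refl α ⟩
      1# - α - 1#               ≈⟨ +-congʳ α′≈1-α ⟨
      α′ - 1#                   ∎

    module Rα  = SixthRoot α α²≈α-1
    module Rα′ = SixthRoot α′ α′²≈α′-1

    η-primitive : IsPrimitiveRoot R k η
    η-primitive = primitive-^ 6 k (s≤s z≤n) ζ-primitive

    η′-primitive : IsPrimitiveRoot R k η′
    η′-primitive = primitive-^ 6 k (s≤s z≤n) (primitive-inverse (6 ℕ.* k) ζζ′≈1 ζ-primitive)

    g : ℕ → Carrier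
    g = 1-x-x⁻¹ ζ ζ′

    ^-6t+1 : ∀ x t → x ^ (6 ℕ.* t ℕ.+ 1) ≈ x * (x ^ 6) ^ t
    ^-6t+1 x t = trans (^-+ x (6 ℕ.* t) 1) (trans (*-cong (^-* x 6 t) (*-identityʳ x)) (*-comm _ _))

    -- Writing the leading 1 as α + α′, and inserting αα′ = 1 and zz′ = 1 where needed, makes the
    -- expression split.
    factor : ∀ t → g (6 ℕ.* t ℕ.+ 1) ≈ α * ((1# - α′ * ζ * η ^ t) * (1# - α′ * ζ′ * η′ ^ t))
    factor t = begin
      1# - ζ ^ j - ζ′ ^ j
        ≈⟨ +-cong (+-congˡ (-‿cong (^-6t+1 ζ t))) (-‿cong (^-6t+1 ζ′ t)) ⟩
      1# - z - z′
        ≈⟨ +-cong (+-cong (sym α+α′≈1) (-‿cong (sym (*-identityˡ z)))) (-‿cong (sym (*-identityˡ z′))) ⟩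
      α + α′ - 1# * z - 1# * z′
        ≈⟨ +-cong (+-cong (+-congˡ (trans (sym (*-identityʳ α′)) (*-cong (sym (*-identityˡ α′)) (sym zz′≈1)))) (-‿cong (*-congʳ (sym αα′≈1)))) (-‿cong (*-congʳ (sym αα′≈1))) ⟩
      α + 1# * α′ * (z * z′) - α * α′ * z - α * α′ * z′
        ≈⟨ +-congʳ (+-congʳ (+-congˡ (*-congʳ (*-congʳ (sym αα′≈1))))) ⟩
      α + α * α′ * α′ * (z * z′) - α * α′ * z - α * α′ * z′     ≈⟨ solve 6 (λ a b x x′ y y′ →
          a :+ a :* b :* b :* ((x :* y) :* (x′ :* y′)) :- a :* b :* (x :* y) :- a :* b :* (x′ :* y′) :=
          a :* ((con (+ 1) :- b :* x :* y) :* (con (+ 1) :- b :* x′ :* y′))) refl α α′ ζ ζ′ (η ^ t) (η′ ^ t) ⟩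
      α * ((1# - α′ * ζ * η ^ t) * (1# - α′ * ζ′ * η′ ^ t))     ∎
      where
      j = 6 ℕ.* t ℕ.+ 1
      z z′ : Carrier
      z  = ζ * η ^ t
      z′ = ζ′ * η′ ^ t
      zz′≈1 : z * z′ ≈ 1#
      zz′≈1 = trans (*-cong (sym (^-6t+1 ζ t)) (sym (^-6t+1 ζ′ t))) (trans (sym (*-^ ζ ζ′ j)) (trans (^-congˡ j ζζ′≈1) (1^ j)))

    h : ℕ → Carrier
    h i = when (¬? (k ∣? i)) (g i)

    sieved-[] : sieved k g [] ≈ ∏ k (λ t → h (6 ℕ.* t ℕ.+ 1))
    sieved-[] = trans (∏-cong (3 ℕ.* k) λ i _ → trans
        (when-cong (survives? k [] i) (unit6? i ×-dec ¬? (k ∣? i)) (λ { (u , k∤ , _) → u , k∤ }) (λ { (u , k∤) → u , k∤ , [] }) (λ _ → refl))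
        (when-× (unit6? i) (¬? (k ∣? i)) (g i)))
      (∏-unit6 k h h-sym)
      where
      h-sym : ∀ i → i ≤ 6 ℕ.* k → h (6 ℕ.* k ℕ.∸ i) ≈ h i
      h-sym i i≤ = when-cong (¬? (k ∣? (6 ℕ.* k ℕ.∸ i))) (¬? (k ∣? i))
        (λ k∤ k∣i → k∤ (k∣j k∣i)) (λ k∤ k∣ → k∤ (∣m+n∣m⇒∣n (≡.subst (k ∣_) (≡.sym (ℕₚ.m∸n+n≡m i≤)) (n∣m*n 6)) k∣))
        (λ _ → begin
          1# - ζ ^ j - ζ′ ^ j
            ≈⟨ +-cong (+-congˡ (-‿cong (inverse-power (6 ℕ.* k) ζζ′≈1 (proj₁ ζ-primitive) i i≤)))
                                        (-‿cong (inverse-power (6 ℕ.* k) (trans (*-comm ζ′ ζ) ζζ′≈1) (proj₁ (primitive-inverse (6 ℕ.* k) ζζ′≈1 ζ-primitive)) i i≤)) ⟩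
          1# - ζ′ ^ i - ζ ^ i
            ≈⟨ solve 2 (λ x y → con (+ 1) :- y :- x := con (+ 1) :- x :- y) refl (ζ ^ i) (ζ′ ^ i) ⟩
          1# - ζ ^ i - ζ′ ^ i     ∎)
        where
        j = 6 ℕ.* k ℕ.∸ i
        k∣j : k ∣ i → k ∣ j
        k∣j k∣i = ∣m+n∣m⇒∣n (≡.subst (k ∣_) (≡.sym (≡.trans (ℕₚ.+-comm i j) (ℕₚ.m∸n+n≡m i≤))) (n∣m*n 6)) k∣i

    unit6-6t+1 : ∀ t → Unit6 (6 ℕ.* t ℕ.+ 1)
    unit6-6t+1 t = inj₁ (≡.trans (≡.cong (ℕ._% 6) (≡.trans (ℕₚ.+-comm (6 ℕ.* t) 1) (≡.cong suc (ℕₚ.*-comm 6 t)))) ([m+kn]%n≡m%n 1 t 6))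

    ∏-all-roots : ∀ {θ} → IsPrimitiveRoot R k θ → ∀ x → ∏ k (λ t → 1# - x * θ ^ t) ≈ 1# - x ^ k
    ∏-all-roots {θ} = go k
      where
      go : ∀ m .{{_ : ℕ.NonZero m}} → IsPrimitiveRoot R m θ → ∀ x → ∏ m (λ t → 1# - x * θ ^ t) ≈ 1# - x ^ m
      go (suc d) prim = ∏-roots θ d prim

    -- Divisors of 6t + 1 are prime to 6, so k divides no index and nothing is left out. As (α′ζ)ᵏ =
    -- α′ᵏα and (α′ζ′)ᵏ = α′ᵏα′, the product expands to αᵏ + α⁻ᵏ - 1, which is 1, -2, -3 for k ≡ 0,
    -- ±2, 3 modulo 6.
    nonunit-product : ¬ Unit6 k → sieved k g [] ≈ α ^ k + α′ ^ k - 1#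
    nonunit-product ¬u = begin
      sieved k g []                                                 ≈⟨ sieved-[] ⟩
      ∏ k (λ t → h (6 ℕ.* t ℕ.+ 1))
        ≈⟨ ∏-cong k (λ t _ → trans (when-yes (¬? (k ∣? (6 ℕ.* t ℕ.+ 1))) (λ k∣ → ¬u (unit6-∣ k∣ (unit6-6t+1 t))) _) (factor t)) ⟩
      ∏ k (λ t → α * (P t * Q t))
        ≈⟨ trans (∏-* k _ _) (*-cong (∏-const k α) (∏-* k P Q)) ⟩
      α ^ k * (∏ k P * ∏ k Q)
        ≈⟨ *-congˡ (*-cong (∏-all-roots η-primitive (α′ * ζ)) (∏-all-roots η′-primitive (α′ * ζ′))) ⟩
      a * ((1# - (α′ * ζ) ^ k) * (1# - (α′ * ζ′) ^ k))
        ≈⟨ *-congˡ (*-cong (+-congˡ (-‿cong (*-^ α′ ζ k))) (+-congˡ (-‿cong (*-^ α′ ζ′ k)))) ⟩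
      a * ((1# - b * α) * (1# - b * α′))
        ≈⟨ solve 4 (λ a b x y → a :* ((con (+ 1) :- b :* x) :* (con (+ 1) :- b :* y)) :=
                                                                         a :- (a :* b) :* (x :+ y) :+ (a :* b) :* b :* (x :* y)) refl a b α α′ ⟩
      a - (a * b) * (α + α′) + (a * b) * b * (α * α′)
        ≈⟨ +-cong (+-congˡ (-‿cong (*-cong ab≈1 α+α′≈1))) (*-cong (*-congʳ ab≈1) αα′≈1) ⟩
      a - 1# * 1# + 1# * b * 1#
        ≈⟨ solve 2 (λ a b → a :- con (+ 1) :* con (+ 1) :+ con (+ 1) :* b :* con (+ 1) := a :+ b :- con (+ 1)) refl a b ⟩
      a + b - 1#                                                    ∎
      where
      a b : Carrier
      a = α ^ k
      b = α′ ^ k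
      P Q : ℕ → Carrier
      P t = 1# - α′ * ζ * η ^ t
      Q t = 1# - α′ * ζ′ * η′ ^ t
      ab≈1 : a * b ≈ 1#
      ab≈1 = trans (sym (*-^ α α′ k)) (trans (^-congˡ k αα′≈1) (1^ k))

    nonunit-value : ∀ r → k ℕ.% 6 ≡ r → ¬ Unit6 k → sieved k g [] ≈ α ^ r + α′ ^ r - 1#
    nonunit-value r ≡.refl ¬u = trans (nonunit-product ¬u) (+-congʳ (+-cong (Rα.^-mod6 k) (Rα′.^-mod6 k)))

    α^4+α′^4 : α ^ 4 + α′ ^ 4 - 1# ≈ - (1# + (1# + 0#))
    α^4+α′^4 = begin
      α ^ 4 + α′ ^ 4 - 1#    ≈⟨ +-congʳ (+-cong Rα.β⁴≈ Rα′.β⁴≈) ⟩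
      - α + - α′ - 1#        ≈⟨ solve 2 (λ a b → :- a :+ :- b :- con (+ 1) := :- (a :+ b) :- con (+ 1)) refl α α′ ⟩
      - (α + α′) - 1#        ≈⟨ +-congʳ (-‿cong α+α′≈1) ⟩
      - 1# - 1#              ≈⟨ solve 0 (:- con (+ 1) :- con (+ 1) := con -[1+ 1 ]) refl ⟩
      - (1# + (1# + 0#))     ∎

    α^2+α′^2 : α ^ 2 + α′ ^ 2 - 1# ≈ - (1# + (1# + 0#))
    α^2+α′^2 = begin
      α ^ 2 + α′ ^ 2 - 1#              ≈⟨ +-congʳ (+-cong Rα.β²≈ Rα′.β²≈) ⟩
      α - 1# + (α′ - 1#) - 1#
        ≈⟨ solve 2 (λ a b → a :- con (+ 1) :+ (b :- con (+ 1)) :- con (+ 1) := (a :+ b) :+ con -[1+ 2 ]) refl α α′ ⟩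
      α + α′ + - (1# + (1# + (1# + 0#)))   ≈⟨ +-congʳ α+α′≈1 ⟩
      1# + - (1# + (1# + (1# + 0#)))       ≈⟨ solve 0 (con (+ 1) :+ con -[1+ 2 ] := con -[1+ 1 ]) refl ⟩
      - (1# + (1# + 0#))               ∎

    -- One t is omitted, so the power of α is p = αᵏ⁻¹, and each root product becomes a geometric
    -- sum. Of the two base points α′αʳ and α′α′ʳ, with r = k % 6, exactly one is 1 and contributes
    -- k: the first for r = 1, the second for r = 5.
    unit-product : Unit6 k → ∃ λ p → p * α ≈ α ^ (k ℕ.% 6) ×
                   sieved k g [] ≈ p * (∑ k ((α′ * α ^ (k ℕ.% 6)) ^_) * ∑ k ((α′ * α′ ^ (k ℕ.% 6)) ^_))
    unit-product u with excludedIndex k u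
    ... | t₀ , t₀<k , eq , only = ∏ k (λ t → when (≢t₀ t) α) ,
      trans (∏-const-except k t₀ t₀<k α) (Rα.^-mod6 k) , (begin
      sieved k g []                                                     ≈⟨ sieved-[] ⟩
      ∏ k (λ t → h (6 ℕ.* t ℕ.+ 1))                                     ≈⟨ ∏-cong k (λ t t<k → trans
                                                                             (when-cong (¬? (k ∣? (6 ℕ.* t ℕ.+ 1))) (≢t₀ t) (λ { k∤ ≡.refl → k∤ k∣6t₀+1 }) (λ t≢ k∣ → t≢ (only t t<k k∣)) (λ _ → factor t))
                                                                             (trans (when-* (≢t₀ t) α _) (*-congˡ (when-* (≢t₀ t) (P t) (Q t))))) ⟩
      ∏ k (λ t → when (≢t₀ t) α * (when (≢t₀ t) (P t) * when (≢t₀ t) (Q t)))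
        ≈⟨ trans (∏-* k _ _) (*-congˡ (∏-* k _ _)) ⟩
      ∏ k (λ t → when (≢t₀ t) α) * (∏ k (λ t → when (≢t₀ t) (P t)) * ∏ k (λ t → when (≢t₀ t) (Q t)))
        ≈⟨ *-congˡ (*-cong (trans (∏-other-roots η k η-primitive t₀ t₀<k (α′ * ζ)) (∑-cong k λ i _ → ^-congˡ i (base-point ζ)))
                           (trans (∏-other-roots η′ k η′-primitive t₀ t₀<k (α′ * ζ′)) (∑-cong k λ i _ → ^-congˡ i (base-point ζ′)))) ⟩
      ∏ k (λ t → when (≢t₀ t) α) * (∑ k ((α′ * α ^ r) ^_) * ∑ k ((α′ * α′ ^ r) ^_)) ∎)
      where
      r = k ℕ.% 6
      ≢t₀ : ∀ t → Dec (t ≢ t₀)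
      ≢t₀ t = ¬? (t ℕ.≟ t₀)
      P Q : ℕ → Carrier
      P t = 1# - α′ * ζ * η ^ t
      Q t = 1# - α′ * ζ′ * η′ ^ t
      k∣6t₀+1 : k ∣ 6 ℕ.* t₀ ℕ.+ 1
      k∣6t₀+1 = ≡.subst (k ∣_) (≡.sym eq) (m∣m*n r)
      -- As 6 t₀ + 1 = k * r, the power of x at the omitted index is the r-th power of x ^ k, which
      -- is α for ζ and α′ for ζ′.
      base-point : ∀ x → α′ * x * (x ^ 6) ^ t₀ ≈ α′ * (x ^ k) ^ r
      base-point x = begin
        α′ * x * (x ^ 6) ^ t₀              ≈⟨ *-assoc _ _ _ ⟩
        α′ * (x * (x ^ 6) ^ t₀)            ≈⟨ *-congˡ (^-6t+1 x t₀) ⟨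
        α′ * x ^ (6 ℕ.* t₀ ℕ.+ 1)          ≡⟨ ≡.cong (λ m → α′ * x ^ m) eq ⟩
        α′ * x ^ (k ℕ.* r)                 ≈⟨ *-congˡ (^-* x k r) ⟩
        α′ * (x ^ k) ^ r                   ∎

    unit-value : ∀ r → k ℕ.% 6 ≡ r → Unit6 k → ∃ λ p → p * α ≈ α ^ r ×
                 sieved k g [] ≈ p * (∑ k ((α′ * α ^ r) ^_) * ∑ k ((α′ * α′ ^ r) ^_))
    unit-value r ≡.refl u = unit-product u

    divide-α : ∀ {p x} → p * α ≈ x → p ≈ x * α′
    divide-α {p} {x} pα≈x = begin
      p                ≈⟨ *-identityʳ p ⟨
      p * 1#           ≈⟨ *-congˡ αα′≈1 ⟨
      p * (α * α′)     ≈⟨ *-assoc _ _ _ ⟨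
      p * α * α′       ≈⟨ *-congʳ pα≈x ⟩
      x * α′           ∎

    ∑-1^ : ∀ {x} → x ≈ 1# → ∑ k (x ^_) ≈ fromℕ R k
    ∑-1^ x≈1 = ∑-1 k λ i _ → trans (^-congˡ i x≈1) (1^ i)

    ∑-ω : ∀ {x} r → k ℕ.% 6 ≡ r → x ≈ α′ * α′ → ∑ k (x ^_) ≈ ∑ r ((α′ * α′) ^_)
    ∑-ω r ≡.refl x≈ω = trans (∑-cong k λ i _ → ^-congˡ i x≈ω) (Rα′.∑-ω-mod6 k)

    sieved-base : sieved k g [] ≈ fromℤ (base k)
    sieved-base with mod6 k
    ... | zero e = trans (nonunit-value 0 e ¬u) (trans
            (solve 0 (con (+ 1) :+ con (+ 1) :- con (+ 1) := con (+ 1)) refl) (trans (sym (+-identityʳ 1#)) (reflexive (≡.cong (λ r → fromℤ (baseMod r k)) (≡.sym e)))))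
      where
      ¬u : ¬ Unit6 k
      ¬u u = unit6⇒2∤ u (∣-mod6⁻ {n = k} 2∣6 e (2 ∣0))
    ... | even (inj₁ e) = trans (nonunit-value 2 e (λ u → unit6⇒2∤ u (∣-mod6⁻ {n = k} 2∣6 e (divides 1 ≡.refl)))) (trans
            α^2+α′^2 (reflexive (≡.cong (λ r → fromℤ (baseMod r k)) (≡.sym e))))
    ... | even (inj₂ e) = trans (nonunit-value 4 e (λ u → unit6⇒2∤ u (∣-mod6⁻ {n = k} 2∣6 e (divides 2 ≡.refl)))) (trans
            α^4+α′^4 (reflexive (≡.cong (λ r → fromℤ (baseMod r k)) (≡.sym e))))
    ... | triple e = trans (nonunit-value 3 e (λ u → unit6⇒3∤ u (∣-mod6⁻ {n = k} 3∣6 e (divides 1 ≡.refl)))) (trans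
            (trans (+-congʳ (+-cong Rα.β³≈ Rα′.β³≈)) (solve 0 (:- con (+ 1) :+ :- con (+ 1) :- con (+ 1) := con -[1+ 2 ]) refl))
            (reflexive (≡.cong (λ r → fromℤ (baseMod r k)) (≡.sym e))))
    ... | unit (inj₁ e) with unit-value 1 e (inj₁ e)
    ...   | p , pα≈α , eq = begin
      sieved k g []                              ≈⟨ eq ⟩
      p * (∑ k ((α′ * α ^ 1) ^_) * ∑ k ((α′ * α′ ^ 1) ^_))
        ≈⟨ *-cong p≈1 (*-cong (∑-1^ (trans (*-congˡ (*-identityʳ α)) (trans (*-comm _ _) αα′≈1)))
                                                          (∑-ω 1 e (*-congˡ (*-identityʳ α′)))) ⟩
      1# * (fromℕ R k * (1# + 0#))
        ≈⟨ solve 1 (λ x → con (+ 1) :* (x :* (con (+ 1) :+ con (+ 0))) := x) refl _ ⟩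
      fromℕ R k                                  ≡⟨ ≡.cong (λ r → fromℤ (baseMod r k)) e ⟨
      fromℤ (base k)                             ∎
      where
      p≈1 : p ≈ 1#
      p≈1 = trans (divide-α pα≈α) (trans (*-congʳ (*-identityʳ α)) αα′≈1)
    -- The first sum, at α′², is α′ and the second, at α′⁶ = 1, is k. With p = α′² the total is α′³k
    -- = -k.
    sieved-base | unit (inj₂ e) with unit-value 5 e (inj₂ e)
    ...   | p , pα≈α⁵ , eq = begin
      sieved k g []                              ≈⟨ eq ⟩
      p * (∑ k ((α′ * α ^ 5) ^_) * ∑ k ((α′ * α′ ^ 5) ^_))
        ≈⟨ *-cong p≈ω (*-cong (trans (∑-ω 5 e (*-congˡ α⁵≈α′)) Rα′.∑-ω-5) (∑-1^ Rα′.β⁶≈)) ⟩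
      α′ * α′ * (α′ * fromℕ R k)
        ≈⟨ solve 2 (λ a x → a :* a :* (a :* x) := (a :* (a :* (a :* con (+ 1)))) :* x) refl α′ _ ⟩
      α′ ^ 3 * fromℕ R k                         ≈⟨ *-congʳ Rα′.β³≈ ⟩
      - 1# * fromℕ R k                           ≈⟨ -1*x≈-x _ ⟩
      - fromℕ R k                                ≈⟨ fromℤ-neg (+ k) ⟨
      fromℤ (ℤ.- (+ k))                          ≡⟨ ≡.cong (λ r → fromℤ (baseMod r k)) e ⟨
      fromℤ (base k)                             ∎
      where
      α⁵≈α′ : α ^ 5 ≈ α′
      α⁵≈α′ = trans Rα.β⁵≈ (sym α′≈1-α)
      p≈ω : p ≈ α′ * α′
      p≈ω = trans (divide-α pα≈α⁵) (*-congʳ α⁵≈α′)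

  -- Induction over the sieving primes

  fromℤ≉0 : CharZero R → ∀ i → i ≢ + 0 → ¬ fromℤ i ≈ 0#
  fromℤ≉0 char (+ 0)       i≢0 _  = i≢0 ≡.refl
  fromℤ≉0 char (+ suc n)   i≢0 eq = char n eq
  fromℤ≉0 char -[1+ n ]    i≢0 eq = char n (trans (sym (-‿involutive _)) (trans (-‿cong eq) -0#≈0#))

  module _ (domain : IsIntegralDomain R) (char : CharZero R) where
    open Domain domain

    -- `sieved-∷` links the product for q ∷ qs to two products for qs: one at level n, and one at
    -- level n / q with ζ replaced by its q-th power, hence the quantification over n and ζ. The
    -- latter is a nonzero integer by `value≢0` and is cancelled.
    sieved-value : ∀ qs n → 1 ≤ n → All Prime qs → All Unit6 qs → All (_∣ n) qs → Unique qs →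
                   ∀ {ζ ζ′} → ζ * ζ′ ≈ 1# → IsPrimitiveRoot R (6 ℕ.* n) ζ →
                   sieved n (1-x-x⁻¹ ζ ζ′) qs ≈ fromℤ (value n qs)
    sieved-value [] n 1≤n _ _ _ _ ζζ′≈1 prim = BaseProduct.sieved-base domain n 1≤n ζζ′≈1 prim
    sieved-value (q ∷ qs) n 1≤n (pq ∷ pqs) (uq ∷ uqs) (divides m ≡.refl ∷ qs∣n) (q∉qs ∷ uniq) {ζ} {ζ′} ζζ′≈1 prim
      rewrite ℕₚ.*-comm m q = *-cancelˡ (fromℤ≉0 char (value m qs) (value≢0 m qs 1≤m uqs)) (begin
        fromℤ (value m qs) * sieved (q ℕ.* m) g (q ∷ qs)
          ≈⟨ *-congʳ (sieved-value qs m 1≤m pqs uqs qs∣m uniq ζ^qζ′^q≈1 prim-q) ⟨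
        sieved m (1-x-x⁻¹ (ζ ^ q) (ζ′ ^ q)) qs * sieved (q ℕ.* m) g (q ∷ qs)  ≈⟨ *-comm _ _ ⟩
        sieved (q ℕ.* m) g (q ∷ qs) * sieved m (1-x-x⁻¹ (ζ ^ q) (ζ′ ^ q)) qs
          ≈⟨ *-congˡ (sieved-cong m qs λ i → +-cong (+-congˡ (-‿cong (^-* ζ q i))) (-‿cong (^-* ζ′ q i))) ⟨
        sieved (q ℕ.* m) g (q ∷ qs) * sieved m (λ i → g (q ℕ.* i)) qs  ≈⟨ sieved-∷ q m g qs pq uq pqs q∉qs ⟩
        sieved (q ℕ.* m) g qs
          ≈⟨ sieved-value qs (q ℕ.* m) 1≤n pqs uqs qs∣n uniq ζζ′≈1 prim ⟩
        fromℤ (value (q ℕ.* m) qs)                                     ≡⟨ ≡.cong fromℤ (value-* q m qs uq) ⟩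
        fromℤ (value (q ℕ.* m) (q ∷ qs) ℤ.* value m qs)
          ≈⟨ fromℤ-* (value (q ℕ.* m) (q ∷ qs)) (value m qs) ⟩
        fromℤ (value (q ℕ.* m) (q ∷ qs)) * fromℤ (value m qs)          ≈⟨ *-comm _ _ ⟩
        fromℤ (value m qs) * fromℤ (value (q ℕ.* m) (q ∷ qs))          ∎)
      where
      g : ℕ → Carrier
      g = 1-x-x⁻¹ ζ ζ′
      1≤m : 1 ≤ m
      1≤m = ℕ.>-nonZero⁻¹ m {{ℕₚ.m*n≢0⇒n≢0 q {{ℕ.>-nonZero 1≤n}}}}
      ζ^qζ′^q≈1 : ζ ^ q * ζ′ ^ q ≈ 1#
      ζ^qζ′^q≈1 = trans (sym (*-^ ζ ζ′ q)) (trans (^-congˡ q ζζ′≈1) (1^ q))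
      arith : ∀ q m → 6 ℕ.* (q ℕ.* m) ≡ q ℕ.* (6 ℕ.* m)
      arith = solve-∀
      prim-q : IsPrimitiveRoot R (6 ℕ.* m) (ζ ^ q)
      prim-q = primitive-^ q (6 ℕ.* m) (unit6⇒≥1 uq) (≡.subst (λ N → IsPrimitiveRoot R N ζ) (arith q m) prim)
      qs∣m : All (_∣ m) qs
      qs∣m = go pqs q∉qs qs∣n
        where
        go : ∀ {rs} → All Prime rs → All (q ≢_) rs → All (_∣ q ℕ.* m) rs → All (_∣ m) rs
        go []         []          []         = []
        go (pr ∷ prs) (q≢r ∷ q∉) (r∣ ∷ rs∣) =
          [ (λ r∣q → ⊥-elim (q≢r (≡.sym (prime-∣ pr pq r∣q)))) , (λ r∣m → r∣m) ]′ (euclidsLemma q m pr r∣) ∷ go prs q∉ rs∣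

  -- The polynomial φ as a sieved product

  index? : ∀ m → Decidable (λ j → 1 ≤ j × 2 ℕ.* j < m × Coprime j m)
  index? m j = (1 ℕ.≤? j) ×-dec ((2 ℕ.* j) ℕ.<? m) ×-dec coprime? j m

  φ-aux≈∏ : ∀ m ζ x N → φ-aux R m ζ x N ≈ ∏ N (λ j → when (index? m j) (fourSinSq R m ζ j - x))
  φ-aux≈∏ m ζ x zero    = refl
  φ-aux≈∏ m ζ x (suc j) with does (index? m j)
  ... | true  = *-congˡ (φ-aux≈∏ m ζ x j)
  ... | false = trans (φ-aux≈∏ m ζ x j) (sym (*-identityˡ _))

  -- The indices from 3n on fail 2j < 6n, and for n ≥ 2 an index prime to 6n is never a multiple of
  -- n.
  φ≈sieved : ∀ n → 2 ≤ n → ∀ {ζ ζ′} → ζ * ζ′ ≈ 1# → IsPrimitiveRoot R (6 ℕ.* n) ζ →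
             φ R (6 ℕ.* n) ζ 1# ≈ sieved n (1-x-x⁻¹ ζ ζ′) (unitPrimes n)
  φ≈sieved n 2≤n {ζ} {ζ′} ζζ′≈1 prim = begin
    φ R m ζ 1#                                      ≈⟨ φ-aux≈∏ m ζ 1# m ⟩
    ∏ m F                                           ≡⟨ ≡.cong (λ N → ∏ N F) (6n≡ n) ⟩
    ∏ (3n ℕ.+ 3n) F                                 ≈⟨ ∏-+ 3n 3n F ⟩
    ∏ 3n F * ∏ 3n (λ i → F (3n ℕ.+ i))              ≈⟨ *-cong (∏-cong 3n lower) (∏-1 3n λ i _ → upper i) ⟩
    sieved n (1-x-x⁻¹ ζ ζ′) (unitPrimes n) * 1#     ≈⟨ *-identityʳ _ ⟩
    sieved n (1-x-x⁻¹ ζ ζ′) (unitPrimes n)          ∎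
    where
    m = 6 ℕ.* n
    3n = 3 ℕ.* n
    F : ℕ → Carrier
    F j = when (index? m j) (fourSinSq R m ζ j - 1#)
    6n≡ : ∀ n → 6 ℕ.* n ≡ 3 ℕ.* n ℕ.+ 3 ℕ.* n
    6n≡ = solve-∀
    2*3n≡ : ∀ n → 6 ℕ.* n ≡ 2 ℕ.* (3 ℕ.* n)
    2*3n≡ = solve-∀
    upper : ∀ i → F (3n ℕ.+ i) ≈ 1#
    upper i = when-no (index? m (3n ℕ.+ i)) (λ { (_ , 2j<m , _) → ℕₚ.<⇒≱ 2j<m
      (≡.subst (_≤ 2 ℕ.* (3n ℕ.+ i)) (≡.sym (2*3n≡ n)) (ℕₚ.*-monoʳ-≤ 2 (ℕₚ.m≤m+n 3n i))) }) (fourSinSq R m ζ (3n ℕ.+ i) - 1#)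
    lower : ∀ i → i < 3n → F i ≈ when (survives? n (unitPrimes n) i) (1-x-x⁻¹ ζ ζ′ i)
    lower i i<3n = when-cong (index? m i) (survives? n (unitPrimes n) i)
      (λ { (_ , _ , cop) → coprime⇒survives n i 2≤n cop })
      (λ s → unit6⇒≥1 (proj₁ s) , ≡.subst (2 ℕ.* i <_) (≡.sym (2*3n≡ n)) (ℕₚ.*-monoʳ-< 2 i<3n) , survives⇒coprime n i 2≤n s)
      (λ _ → begin
        1# + 1# - ζ ^ i - ζ ^ (m ℕ.∸ i) - 1#
          ≈⟨ +-congʳ (+-congˡ (-‿cong (inverse-power m ζζ′≈1 (proj₁ prim) i i≤m))) ⟩
        1# + 1# - ζ ^ i - ζ′ ^ i - 1#
          ≈⟨ solve 2 (λ x y → con (+ 1) :+ con (+ 1) :- x :- y :- con (+ 1) := con (+ 1) :- x :- y) refl _ _ ⟩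
        1# - ζ ^ i - ζ′ ^ i                     ∎)
      where
      i≤m : i ≤ m
      i≤m = ℕₚ.≤-trans (ℕₚ.<⇒≤ i<3n) (≡.subst (3n ≤_) (≡.sym (6n≡ n)) (ℕₚ.m≤m+n 3n 3n))

  φ≈value : IsIntegralDomain R → CharZero R → ∀ n → 2 ≤ n → ∀ ζ → IsPrimitiveRoot R (6 ℕ.* n) ζ →
            φ R (6 ℕ.* n) ζ 1# ≈ fromℤ (value n (unitPrimes n))
  φ≈value domain char n@(suc n′) 2≤n ζ prim = trans (φ≈sieved n 2≤n ζζ′≈1 prim)
    (sieved-value domain char (unitPrimes n) n (ℕₚ.<⇒≤ 2≤n)
      (All.tabulate (λ q∈ → proj₁ (∈-unitPrimes⁻ {n} q∈)))
      (All.tabulate (λ q∈ → proj₁ (proj₂ (∈-unitPrimes⁻ {n} q∈))))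
      (All.tabulate (λ q∈ → proj₂ (proj₂ (∈-unitPrimes⁻ {n} q∈))))
      (unitPrimes-unique n) ζζ′≈1 prim)
    where
    -- The inverse of ζ is its power 6n - 1. This exponent is spelled so that 6 * n reduces to its
    -- successor, and the equation is literally that of primitivity.
    ζζ′≈1 : ζ * ζ ^ (n′ ℕ.+ 5 ℕ.* n) ≈ 1#
    ζζ′≈1 = proj₁ prim

open import Data.Nat using (_*_; _%_)

theorem5 : ∀ {c ℓ : Level} (R : CommutativeRing c ℓ) → IsIntegralDomain R → CharZero R →
    ∀ (n : ℕ) → 3 ≤ n → ∀ (ζ : CommutativeRing.Carrier R) → IsPrimitiveRoot R (6 * n) ζ →
    ∀ (w : ℕ) → IsV n w →
    ((w % 3 ≡ 1 →
    CommutativeRing._≈_ R (φ R (6 * n) ζ (CommutativeRing.1# R)) (fromℕ R w))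
    × ((w % 3 ≡ 2) ⊎ (w ≡ 2) ⊎ (w ≡ 3) →
    CommutativeRing._≈_ R (φ R (6 * n) ζ (CommutativeRing.1# R))
    (CommutativeRing.-_ R (fromℕ R w))))
theorem5 R domain char n 3≤n ζ prim w v =
  (λ h → trans main (reflexive (≡.cong fromℤ (proj₁ (value-v n w 3≤n v) h)))) ,
  (λ h → trans main (trans (reflexive (≡.cong fromℤ (proj₂ (value-v n w 3≤n v) h))) (fromℤ-neg (+ w))))
  where
  open CommutativeRing R using (trans; reflexive; _≈_; 1#)
  open OverRing R using (fromℤ; fromℤ-neg)
  main : φ R (6 * n) ζ 1# ≈ fromℤ (value n (unitPrimes n))
  main = OverRing.φ≈value R domain char n (ℕₚ.<⇒≤ 3≤n) ζ prim
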